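{- Let $\lambda \supseteq \mu$ be partitions and let $n$ be an integer with $n \ge \ell(\lambda)$ and $n \ge \ell(\mu)$. Then $$ g_{\lambda/\mu} = \det\left[\varphi^{i - j} h_{\lambda_i - i -\mu_j + j} \right]_{1 \le i, j \le n}. $$
   Context: $\ell(\lambda)$ is the number of nonzero parts of the partition $\lambda$, and $\lambda_i=0$ for $i>\ell(\lambda)$. For $\lambda\supseteq\mu$, a reverse plane partition (RPP) of shape $\lambda/\mu$ is a filling of the boxes of the skew Young diagram $\lambda/\mu$ (English notation) by positive integers weakly increasing along rows left to right and columns top to bottom; $g_{\lambda/\mu}(\mathbf{x})=\sum_T\prod_{i\ge1}x_i^{c_i(T)}$ summed over RPPs $T$ of shape $\lambda/\mu$, where $c_i(T)$ is the number of columns of $T$ containing $i$ (a symmetric function in $\mathbf{x}=(x_1,x_2,\ldots)$). $\Lambda$ is the ring of symmetric functions, $h_k$ the complete homogeneous symmetric functions with $h_0=1$, $h_k=0$ for $k<0$. $\varphi:\Lambda\to\Lambda$ is the ring automorphism determined by $\varphi(h_k)=h_k+h_{k-1}+\cdots+h_0$ for $k\ge1$; for all integers $\ell$ and $k$ one has $\varphi^{\ell}h_k=\sum_{r=0}^{k}\binom{\ell+r-1}{r}h_{k-r}$ (in particular $\varphi^{ -1}h_k=h_k-h_{k-1}$, and for $\ell\ge0$, $\varphi^\ell h_k(\mathbf{x})=h_k(1^\ell,\mathbf{x})$, the evaluation with $\ell$ extra variables equal to $1$). -}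

module Defs where

open import Level using (Level)
open import Data.Bool using (Bool; true; false; _∧_; if_then_else_)
open import Data.Nat as ℕ using (ℕ; zero; suc; _≤_; _<_; _≤ᵇ_; _≡ᵇ_; _∸_)
open import Data.Nat.Combinatorics using (_C_)
open import Data.Integer as ℤ using (ℤ; +_; -[1+_])
open import Data.Fin using (Fin; toℕ; punchIn)
import Data.Fin as F
open import Data.List using (List; []; _∷_; map; concatMap; upTo; length; foldr; zip)
open import Data.Bool.ListAction using (all; any)
open import Data.List.Relation.Unary.All using (All)
open import Data.List.Relation.Unary.Linked using (Linked)
open import Data.Product using (_×_; _,_)
open import Algebra.Bundles using (CommutativeRing)

IsPartition : List ℕ → Set
IsPartition l = Linked (λ a b → b ≤ a) l × All (0 <_) l

_‼_ : List ℕ → ℕ → ℕ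
[] ‼ i = 0
(a ∷ l) ‼ zero = a
(a ∷ l) ‼ suc i = l ‼ i

-- λ_i, 1-indexed; λ_i = 0 for i > ℓ(λ) (and λ_0 := 0, never used)
part : List ℕ → ℕ → ℕ
part l zero = 0
part l (suc i) = l ‼ i

_⊇_ : List ℕ → List ℕ → Set
la ⊇ mu = ∀ i → part mu i ≤ part la i

range : ℕ → ℕ → List ℕ
range a b = map (λ t → a ℕ.+ suc t) (upTo (b ∸ a))

-- the boxes (i , j) (row i, column j, 1-indexed) of λ/μ
cells : List ℕ → List ℕ → List (ℕ × ℕ)
cells la mu = concatMap (λ i → map (λ j → (i , j)) (range (part mu i) (part la i)))
                        (range 0 (length la))

words : ℕ → ℕ → List (List ℕ)
words m zero = [] ∷ []
words m (suc k) = concatMap (λ a → map (a ∷_) (words m k)) (range 0 m)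

-- a filling: list of (box , entry)
Filling : Set
Filling = List ((ℕ × ℕ) × ℕ)

adjacent : ℕ × ℕ → ℕ × ℕ → Bool
adjacent (i , j) (i' , j') = ((i' ≡ᵇ i) ∧ (j' ≡ᵇ suc j)) Data.Bool.∨ ((i' ≡ᵇ suc i) ∧ (j' ≡ᵇ j))

isRPP : Filling → Bool
isRPP T = all (λ { (c , a) → all (λ { (c' , b) → if adjacent c c' then a ≤ᵇ b else true }) T }) T

count : {A : Set} → (A → Bool) → List A → ℕ
count p = foldr (λ a n → if p a then suc n else n) 0

-- c_v(T): number of columns of T containing the entry v
-- (columns of λ/μ lie among 1, …, λ₁)
colCount : List ℕ → Filling → ℕ → ℕ
colCount la T v = count (λ j → any (λ { ((r , c) , w) → (c ≡ᵇ j) ∧ (w ≡ᵇ v) }) T)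
                        (range 0 (part la 1))

rpps : ℕ → List ℕ → List ℕ → List Filling
rpps m la mu = foldr (λ w acc → let T = zip (cells la mu) w in
                                  if isRPP T then T ∷ acc else acc)
                     [] (words m (length (cells la mu)))

sortedᵇ : List ℕ → Bool
sortedᵇ [] = true
sortedᵇ (a ∷ []) = true
sortedᵇ (a ∷ b ∷ l) = (a ≤ᵇ b) ∧ sortedᵇ (b ∷ l)

-- Generalised binomial coefficient  binom(a, r) = a(a-1)…(a-r+1)/r!
-- for a ∈ ℤ, r ∈ ℕ.  For a = -(b+1) < 0 it equals (-1)^r binom(b+r, r).

binomℤ : ℤ → ℕ → ℤ
binomℤ (+ a) r = + (a C r)
binomℤ -[1+ b ] r = signPow r ℤ.* + ((b ℕ.+ r) C r)
  where
  signPow : ℕ → ℤ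
  signPow zero = + 1
  signPow (suc k) = ℤ.- signPow k

-- Evaluation in a commutative ring R, in the finitely many variables
-- x 1, …, x m (all other variables set to 0).

module _ {c ℓ : Level} (R : CommutativeRing c ℓ) where
  open CommutativeRing R

  sumR : List Carrier → Carrier
  sumR = foldr _+_ 0#

  prodR : List Carrier → Carrier
  prodR = foldr _*_ 1#

  powR : Carrier → ℕ → Carrier
  powR a zero = 1#
  powR a (suc k) = a * powR a k

  natR : ℕ → Carrier
  natR zero = 0#
  natR (suc k) = 1# + natR k

  intR : ℤ → Carrier
  intR (+ k) = natR k
  intR -[1+ k ] = - natR (suc k)

  gR : (m : ℕ) → (ℕ → Carrier) → List ℕ → List ℕ → Carrier
  gR m x la mu = sumR (map (λ T → prodR (map (λ v → powR (x v) (colCount la T v)) (range 0 m)))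
                           (rpps m la mu))

  hR : (m : ℕ) → (ℕ → Carrier) → ℤ → Carrier
  hR m x (+ k) = sumR (foldr (λ w acc → if sortedᵇ w then prodR (map x w) ∷ acc else acc)
                             [] (words m k))
  hR m x -[1+ k ] = 0#

  φhR : (m : ℕ) → (ℕ → Carrier) → ℤ → ℤ → Carrier
  φhR m x l (+ k) = sumR (map (λ r → intR (binomℤ (l ℤ.+ + r ℤ.- + 1) r) * hR m x (+ k ℤ.- + r))
                              (upTo (suc k)))
  φhR m x l -[1+ k ] = 0#

  det : (n : ℕ) → (Fin n → Fin n → Carrier) → Carrier
  det zero M = 1#
  det (suc n) M = sumR (map (λ j → sgn (toℕ j) * (M F.zero j * det n (λ r s → M (F.suc r) (punchIn j s))))
                            (Data.List.allFin (suc n)))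
    where
    sgn : ℕ → Carrier
    sgn zero = 1#
    sgn (suc k) = - sgn k

  jtMatrix : (m : ℕ) → (ℕ → Carrier) → List ℕ → List ℕ → (n : ℕ) → Fin n → Fin n → Carrier
  jtMatrix m x la mu n i' j' =
    let i = suc (toℕ i') ; j = suc (toℕ j') in
    φhR m x (+ i ℤ.- + j) (+ part la i ℤ.- + i ℤ.- + part mu j ℤ.+ + j)

{-# OPTIONS --safe #-}

-- Row i of the matrix, as a function of z = λ_i - i, satisfies two recurrences, one for a new variable and
-- one for a new row:
--   R_i^(f+1)(z) = R_i^f(z) + x_(f+1) R_i^(f+1)(z - 1)   and   R_(i+1)(z) = R_(i+1)(z - 1) + R_i(z).
-- Bound the entries by f in the first rows and by f + 1 in the rows from i on, and let b = λ_i > μ_i. By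
-- the first recurrence the determinant is the one where row i is bounded by f as well, plus x_(f+1) times
-- the one where λ_i is b - 1; in the latter, the second recurrence (as a row operation) lets every further
-- row of length b be shortened to b - 1 (if b = μ_i, it has a zero block and vanishes). Reverse plane
-- partitions obey the same rule: if the entry of the box (i , b) is at most f, so is all of row i; if it is
-- f + 1, so is the rest of column b below it, and deleting these boxes costs one factor x_(f+1). Both sides
-- are therefore determined by the case without variables, where the matrix is unitriangular if λ = μ and
-- singular otherwise.
module Submission where

open import Defs
open import Level using (Level)
open import Algebra.Bundles using (CommutativeRing; Monoid)
open import Data.Bool using (Bool; true; false; _∧_; _∨_; if_then_else_; T)
open import Data.Bool.ListAction using (any; or)
import Data.Bool.Properties as 𝔹ₚ
open import Data.Empty using (⊥-elim)
open import Data.Fin as F using (Fin; toℕ; punchIn)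
open import Data.Integer as ℤ using (ℤ; +_; -[1+_]; _⊖_; _◃_)
import Data.Integer.Properties as ℤₚ
import Data.Integer.Tactic.RingSolver as ℤSolver
open import Data.List using (List; []; _∷_; _++_; map; concatMap; upTo; applyUpTo; length; tabulate; foldr; zip)
import Data.List.Properties as Lₚ
open import Data.List.Membership.Propositional using (_∈_)
open import Data.List.Membership.Propositional.Properties using (∈-++⁺ˡ; ∈-++⁺ʳ; ∈-++⁻)
open import Data.List.Relation.Binary.Permutation.Propositional using (_↭_; ↭-sym; ↭-trans; ↭-reflexive)
import Data.List.Relation.Binary.Permutation.Propositional as Perm
open import Data.List.Relation.Binary.Permutation.Propositional.Properties using (∈-resp-↭; Any-resp-↭; ++-comm; shift; ++⁺; ++⁺ˡ; ++⁺ʳ)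
open import Data.List.Relation.Unary.All as All using (All; []; _∷_)
import Data.List.Relation.Unary.All.Properties as Allₚ
open import Data.List.Relation.Unary.Any using (here)
import Data.List.Relation.Unary.Any.Properties as Anyₚ
open import Data.List.Relation.Unary.Linked using (Linked; []; [-]; _∷_)
open import Data.Nat as ℕ using (ℕ; zero; suc; _≤_; _≤ᵇ_; _≡ᵇ_)
open import Data.Nat.Combinatorics using (_C_; nCk+nC[k+1]≡[n+1]C[k+1]; k>n⇒nCk≡0; nCn≡1)
import Data.Nat.Properties as ℕₚ
open import Data.Product using (Σ; _×_; _,_; proj₁; proj₂; ∃-syntax)
open import Data.Sign as S using (Sign)
open import Data.Sum using (_⊎_; inj₁; inj₂)
open import Data.Unit using (⊤; tt)
open import Function using (_∘_; id; Equivalence)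
open import Relation.Binary.PropositionalEquality as ≡ using (_≡_; _≢_)
open import Relation.Nullary using (yes; no)
import Algebra.Properties.Ring as RingProperties
import Algebra.Solver.Ring.NaturalCoefficients.Default as SemiringSolver
import Relation.Binary.Reasoning.Setoid as SetoidReasoning
import Tactic.MonoidSolver as MonoidSolver

-- The recurrences act on one row at a time, whereas the theorem allows the same variables in every
-- row; hence the induction has to run over mixed bounds, and their order matters. The rows above
-- row i are bounded by f, so f + 1 occurs in column b only inside the deleted strip, and exactly
-- one column loses this entry. The rows from i on share the bound f + 1, so the second recurrence
-- is available between neighbours: row i of length b - 1 and row i + 1 of length b have the same z,
-- and subtracting the former from the latter shortens the latter. Shortening row i alone would in
-- general not leave a partition. On both sides the correction reaches the same rows, those of
-- length b from i on, and this coincidence lets the determinant and the generating function satisfy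
-- one recursion.

-- Determinants as iterated expansions along the first row

module Determinants {c ℓ : Level} (R : CommutativeRing c ℓ) where
  open CommutativeRing R
  open RingProperties ring using (-0#≈0#; -‿+-comm; -‿distribˡ-*; -‿distribʳ-*)
  open SemiringSolver commutativeSemiring using (solve; _:+_; _:*_; _:=_)
  open SetoidReasoning setoid

  private
    variable
      X : Set

  -- This is expansion along the row `r`: the alternating sum of `r y` times `f` at the list without
  -- `y`. In other words, it is the exterior product of the linear form `r` with `f`, evaluated at
  -- the listed columns.
  contract : (X → Carrier) → (List X → Carrier) → List X → Carrier
  contract r f []       = 0#
  contract r f (y ∷ ys) = r y * f ys - contract r (λ zs → f (y ∷ zs)) ys

  -- Rows are functions on column labels; the value is 0 unless there are as many rows as columns.
  detL : List (X → Carrier) → List X → Carrier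
  detL []       []      = 1#
  detL []       (_ ∷ _) = 0#
  detL (r ∷ rs) cs      = contract r (detL rs) cs

  contract-cong : ∀ {r s : X → Carrier} {f g : List X → Carrier} → (∀ y → r y ≈ s y) →
                  (∀ ys → f ys ≈ g ys) → ∀ ys → contract r f ys ≈ contract s g ys
  contract-cong r≈s f≈g []       = refl
  contract-cong r≈s f≈g (y ∷ ys) =
    +-cong (*-cong (r≈s y) (f≈g ys)) (-‿cong (contract-cong r≈s (λ zs → f≈g (y ∷ zs)) ys))

  neg-linear : ∀ u a v → - (u + a * v) ≈ - u + a * - v
  neg-linear u a v = trans (sym (-‿+-comm u (a * v))) (+-congˡ (-‿distribʳ-* a v))

  contract-linearˡ : ∀ (r s : X → Carrier) a (f : List X → Carrier) ys →
                     contract (λ y → r y + a * s y) f ys ≈ contract r f ys + a * contract s f ys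
  contract-linearˡ r s a f []       = sym (trans (+-identityˡ _) (zeroʳ a))
  contract-linearˡ r s a f (y ∷ ys) =
    trans (+-congˡ (trans (-‿cong (contract-linearˡ r s a (λ zs → f (y ∷ zs)) ys)) (neg-linear _ a _)))
      (solve 6 (λ p q a u v w → (p :+ a :* q) :* u :+ (v :+ a :* w) :=
                                (p :* u :+ v) :+ a :* (q :* u :+ w)) refl _ _ _ _ _ _)

  contract-linearʳ : ∀ (r : X → Carrier) a (f g : List X → Carrier) ys →
                     contract r (λ zs → f zs + a * g zs) ys ≈ contract r f ys + a * contract r g ys
  contract-linearʳ r a f g []       = sym (trans (+-identityˡ _) (zeroʳ a))
  contract-linearʳ r a f g (y ∷ ys) =
    trans (+-congˡ (trans (-‿cong (contract-linearʳ r a (λ zs → f (y ∷ zs)) (λ zs → g (y ∷ zs)) ys))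
                          (neg-linear _ a _)))
      (solve 6 (λ p a u t v w → p :* (u :+ a :* t) :+ (v :+ a :* w) :=
                                (p :* u :+ v) :+ a :* (p :* t :+ w)) refl _ _ _ _ _ _)

  contract-zeroʳ : ∀ (r : X → Carrier) {f : List X → Carrier} → (∀ ys → f ys ≈ 0#) →
                   ∀ ys → contract r f ys ≈ 0#
  contract-zeroʳ r f≈0 []       = refl
  contract-zeroʳ r {f} f≈0 (y ∷ ys) = begin
    r y * f ys - contract r (λ zs → f (y ∷ zs)) ys
      ≈⟨ +-cong (*-congˡ (f≈0 ys)) (-‿cong (contract-zeroʳ r (λ zs → f≈0 (y ∷ zs)) ys)) ⟩
    r y * 0# - 0#  ≈⟨ +-cong (zeroʳ _) -0#≈0# ⟩
    0# + 0#        ≈⟨ +-identityʳ 0# ⟩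
    0#             ∎

  -- Every pair of columns is removed in both orders, with opposite signs. In the induction, the
  -- terms that use the head `y` in the outer and in the inner expansion cancel, and the terms that
  -- keep `y` form the same double expansion on a shorter list.
  contract-contract : ∀ (r : X → Carrier) (f : List X → Carrier) ys →
                      contract r (contract r f) ys ≈ 0#
  contract-contract r f []       = refl
  contract-contract r f (y ∷ ys) = begin
    r y * A - contract r (λ zs → contract r f (y ∷ zs)) ys
      ≈⟨ +-congˡ (-‿cong (contract-cong (λ _ → refl) (λ zs → +-congˡ (sym (*-identityˡ _))) ys)) ⟩
    r y * A - contract r (λ zs → r y * f zs + 1# * - B zs) ys
      ≈⟨ +-congˡ (-‿cong (contract-linearʳ r 1# (λ zs → r y * f zs) (λ zs → - B zs) ys)) ⟩
    r y * A - (contract r (λ zs → r y * f zs) ys + 1# * contract r (λ zs → - B zs) ys)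
      ≈⟨ +-congˡ (-‿cong (+-cong (scale (r y) f ys) (trans (*-identityˡ _) (neg ys)))) ⟩
    r y * A - (r y * A + 0#)
      ≈⟨ +-congˡ (-‿cong (+-identityʳ _)) ⟩
    r y * A - r y * A
      ≈⟨ -‿inverseʳ _ ⟩
    0# ∎
    where
    A = contract r f ys
    B = contract r (λ zs → f (y ∷ zs))

    scale : ∀ a (g : List _ → Carrier) ys → contract r (λ zs → a * g zs) ys ≈ a * contract r g ys
    scale a g ys = begin
      contract r (λ zs → a * g zs) ys
        ≈⟨ contract-cong (λ _ → refl) (λ _ → sym (+-identityˡ _)) ys ⟩
      contract r (λ zs → 0# + a * g zs) ys
        ≈⟨ contract-linearʳ r a (λ _ → 0#) g ys ⟩
      contract r (λ _ → 0#) ys + a * contract r g ys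
        ≈⟨ +-congʳ (contract-zeroʳ r (λ _ → refl) ys) ⟩
      0# + a * contract r g ys
        ≈⟨ +-identityˡ _ ⟩
      a * contract r g ys ∎

    neg : ∀ ys → contract r (λ zs → - B zs) ys ≈ 0#
    neg ys = begin
      contract r (λ zs → - B zs) ys
        ≈⟨ contract-cong (λ _ → refl) (λ _ → trans (-‿cong (sym (*-identityˡ _))) (-‿distribˡ-* _ _)) ys ⟩
      contract r (λ zs → - 1# * B zs) ys  ≈⟨ scale (- 1#) B ys ⟩
      - 1# * contract r B ys              ≈⟨ *-congˡ (contract-contract r (λ zs → f (y ∷ zs)) ys) ⟩
      - 1# * 0#                           ≈⟨ zeroʳ _ ⟩
      0#                                  ∎

  detL-linear : ∀ (pre : List (X → Carrier)) {r s t : X → Carrier} {a} post →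
                (∀ y → r y ≈ s y + a * t y) → ∀ ys →
                detL (pre ++ r ∷ post) ys ≈ detL (pre ++ s ∷ post) ys + a * detL (pre ++ t ∷ post) ys
  detL-linear []        {r} {s} {t} {a} post eq ys =
    trans (contract-cong eq (λ _ → refl) ys) (contract-linearˡ s t a (detL post) ys)
  detL-linear (q ∷ pre) post eq ys =
    trans (contract-cong (λ _ → refl) (detL-linear pre post eq) ys)
      (contract-linearʳ q _ _ _ ys)

  detL-repeated : ∀ (pre : List (X → Carrier)) r post ys → detL (pre ++ r ∷ r ∷ post) ys ≈ 0#
  detL-repeated []        r post ys = contract-contract r (detL post) ys
  detL-repeated (q ∷ pre) r post ys = contract-zeroʳ q (detL-repeated pre r post) ys

  -- Linearity in the second of two neighbouring rows leaves an error term with a repeated row.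
  -- Neighbours suffice because the second recurrence relates consecutive rows.
  detL-subtract : ∀ (pre : List (X → Carrier)) {r s t : X → Carrier} post →
                  (∀ y → s y ≈ t y + 1# * r y) → ∀ ys →
                  detL (pre ++ r ∷ s ∷ post) ys ≈ detL (pre ++ r ∷ t ∷ post) ys
  detL-subtract pre {r} {s} {t} post eq ys = begin
    detL (pre ++ r ∷ s ∷ post) ys
      ≈⟨ reflexive (≡.cong (λ l → detL l ys) (≡.sym (Lₚ.++-assoc pre (r ∷ []) (s ∷ post)))) ⟩
    detL ((pre ++ r ∷ []) ++ s ∷ post) ys
      ≈⟨ detL-linear (pre ++ r ∷ []) post eq ys ⟩
    detL ((pre ++ r ∷ []) ++ t ∷ post) ys + 1# * detL ((pre ++ r ∷ []) ++ r ∷ post) ys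
      ≈⟨ +-cong (reflexive (≡.cong (λ l → detL l ys) (Lₚ.++-assoc pre (r ∷ []) (t ∷ post))))
                (*-congˡ (reflexive (≡.cong (λ l → detL l ys) (Lₚ.++-assoc pre (r ∷ []) (r ∷ post))))) ⟩
    detL (pre ++ r ∷ t ∷ post) ys + 1# * detL (pre ++ r ∷ r ∷ post) ys
      ≈⟨ +-congˡ (*-congˡ (detL-repeated pre r post ys)) ⟩
    detL (pre ++ r ∷ t ∷ post) ys + 1# * 0#
      ≈⟨ +-congˡ (zeroʳ 1#) ⟩
    detL (pre ++ r ∷ t ∷ post) ys + 0#
      ≈⟨ +-identityʳ _ ⟩
    detL (pre ++ r ∷ t ∷ post) ys ∎

  VanishesOn : List X → (X → Carrier) → Set ℓ
  VanishesOn ys r = All (λ y → r y ≈ 0#) ys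

  contract-zeroˡ : ∀ {r : X → Carrier} f {ys} → VanishesOn ys r → contract r f ys ≈ 0#
  contract-zeroˡ f []       = refl
  contract-zeroˡ {r = r} f {y ∷ ys} (p ∷ ps) = begin
    r y * f ys - contract r (λ zs → f (y ∷ zs)) ys
      ≈⟨ +-cong (*-congʳ p) (-‿cong (contract-zeroˡ (λ zs → f (y ∷ zs)) ps)) ⟩
    0# * f ys - 0#  ≈⟨ +-cong (zeroˡ _) -0#≈0# ⟩
    0# + 0#         ≈⟨ +-identityʳ 0# ⟩
    0#              ∎

  detL-zeroColumn : ∀ {y : X} rs → All (λ r → r y ≈ 0#) rs → ∀ ys → detL rs (y ∷ ys) ≈ 0#
  detL-zeroColumn []       []       ys = refl
  detL-zeroColumn {y = y} (r ∷ rs) (p ∷ ps) ys = begin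
    r y * detL rs ys - contract r (λ zs → detL rs (y ∷ zs)) ys
      ≈⟨ +-cong (*-congʳ p) (-‿cong (contract-zeroʳ r (detL-zeroColumn rs ps) ys)) ⟩
    0# * detL rs ys - 0#  ≈⟨ +-cong (zeroˡ _) -0#≈0# ⟩
    0# + 0#               ≈⟨ +-identityʳ 0# ⟩
    0#                    ∎

  detL-unitColumn : ∀ {y : X} r rs → r y ≈ 1# → All (λ s → s y ≈ 0#) rs → ∀ ys →
                    detL (r ∷ rs) (y ∷ ys) ≈ detL rs ys
  detL-unitColumn {y = y} r rs p ps ys = begin
    r y * detL rs ys - contract r (λ zs → detL rs (y ∷ zs)) ys
      ≈⟨ +-cong (*-congʳ p) (-‿cong (contract-zeroʳ r (detL-zeroColumn rs ps) ys)) ⟩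
    1# * detL rs ys - 0#  ≈⟨ +-cong (*-identityˡ _) -0#≈0# ⟩
    detL rs ys + 0#       ≈⟨ +-identityʳ _ ⟩
    detL rs ys            ∎

  -- Each term of the expansion omits one column, either from `xs`, which shortens the prefix by
  -- one, or from `ys`, which leaves it alone. The columns that remain in the prefix still satisfy
  -- `P`.
  contract-zero : ∀ {p} {P : X → Set p} (r : X → Carrier) f {xs} ys → All P xs →
                  (∀ {xs′} zs → All P xs′ → length xs ℕ.≤ suc (length xs′) → f (xs′ ++ zs) ≈ 0#) →
                  contract r f (xs ++ ys) ≈ 0#
  contract-zero r f {[]}     ys []       f≈0 = contract-zeroʳ r (λ zs → f≈0 zs [] ℕ.z≤n) ys
  contract-zero r f {x ∷ xs} ys (p ∷ ps) f≈0 = begin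
    r x * f (xs ++ ys) - contract r (λ zs → f (x ∷ zs)) (xs ++ ys)
      ≈⟨ +-cong (*-congˡ (f≈0 ys ps ℕₚ.≤-refl))
                (-‿cong (contract-zero r (λ zs → f (x ∷ zs)) ys ps
                           (λ zs qs le → f≈0 zs (p ∷ qs) (ℕ.s≤s le)))) ⟩
    r x * 0# - 0#  ≈⟨ +-cong (zeroʳ _) -0#≈0# ⟩
    0# + 0#        ≈⟨ +-identityʳ 0# ⟩
    0#             ∎

  -- Expanding along a row of `ps` uses up at most one column of `xs`. There are more of these
  -- columns than rows in `ps`, so one is left at the front when `qs` is reached, and all of `qs` is
  -- zero there.
  detL-zeroBlock : ∀ (ps qs : List (X → Carrier)) {xs} ys → length ps ℕ.< length xs →
                   All (λ x → All (λ q → q x ≈ 0#) qs) xs → detL (ps ++ qs) (xs ++ ys) ≈ 0#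
  detL-zeroBlock []       qs {x ∷ xs} ys lt        (z ∷ _) = detL-zeroColumn qs z (xs ++ ys)
  detL-zeroBlock (p ∷ ps) qs          ys lt zs =
    contract-zero p (detL (ps ++ qs)) ys zs
      (λ ys′ zs′ le → detL-zeroBlock ps qs ys′ (ℕ.s≤s⁻¹ (ℕₚ.≤-trans lt le)) zs′)

  sign : ℕ → Carrier
  sign zero    = 1#
  sign (suc k) = - sign k

  -- The sign function in the definition of det has no accessible name, so it is solved for by unification.
  mutual
    detTerm : ∀ n → (Fin (suc n) → Fin (suc n) → Carrier) → Fin (suc n) → Carrier
    detTerm n M = proj₁ (det-suc n M)

    det-suc : ∀ n M → Σ (Fin (suc n) → Carrier) λ t →
              det R (suc n) M ≡ sumR R (map t (Data.List.allFin (suc n)))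
    det-suc n M = _ , ≡.refl

  mutual
    detSign : ∀ n → (Fin (suc n) → Fin (suc n) → Carrier) → ℕ → Carrier
    detSign = _

    detTerm≡ : ∀ n M j → detTerm n M j ≡ detSign n M (toℕ j) *
                 (M F.zero j * det R n (λ r s → M (F.suc r) (punchIn j s)))
    detTerm≡ n M j with toℕ j
    ... | k = ≡.refl

  detSign≡sign : ∀ n M k → detSign n M k ≡ sign k
  detSign≡sign n M zero    = ≡.refl
  detSign≡sign n M (suc k) = ≡.cong -_ (detSign≡sign n M k)

  sumR-tabulate-cong : ∀ {n} {s t : Fin n → Carrier} → (∀ j → s j ≈ t j) →
                       sumR R (tabulate s) ≈ sumR R (tabulate t)
  sumR-tabulate-cong {zero}  s≈t = refl
  sumR-tabulate-cong {suc n} s≈t = +-cong (s≈t F.zero) (sumR-tabulate-cong (λ j → s≈t (F.suc j)))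

  sumR-tabulate-neg : ∀ {n} (s : Fin n → Carrier) →
                      sumR R (tabulate (λ j → - s j)) ≈ - sumR R (tabulate s)
  sumR-tabulate-neg {zero}  s = sym -0#≈0#
  sumR-tabulate-neg {suc n} s = trans (+-congˡ (sumR-tabulate-neg (λ j → s (F.suc j)))) (-‿+-comm _ _)

  contract-tabulate : ∀ n (r : X → Carrier) f (e : Fin (suc n) → X) →
    sumR R (tabulate (λ j → sign (toℕ j) * (r (e j) * f (tabulate (λ s → e (punchIn j s)))))) ≈
    contract r f (tabulate e)
  contract-tabulate zero r f e = begin
    1# * (r (e F.zero) * f []) + 0#  ≈⟨ +-congʳ (*-identityˡ _) ⟩
    r (e F.zero) * f [] + 0#         ≈⟨ +-congˡ (sym -0#≈0#) ⟩
    r (e F.zero) * f [] - 0#         ∎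
  contract-tabulate (suc n) r f e = +-cong (*-identityˡ _) (begin
    sumR R (tabulate (λ j → - sign (toℕ j) * t j))
      ≈⟨ sumR-tabulate-cong (λ j → sym (-‿distribˡ-* (sign (toℕ j)) (t j))) ⟩
    sumR R (tabulate (λ j → - (sign (toℕ j) * t j)))
      ≈⟨ sumR-tabulate-neg (λ j → sign (toℕ j) * t j) ⟩
    - sumR R (tabulate (λ j → sign (toℕ j) * t j))
      ≈⟨ -‿cong (contract-tabulate n r (λ zs → f (e F.zero ∷ zs)) (λ s → e (F.suc s))) ⟩
    - contract r (λ zs → f (e F.zero ∷ zs)) (tabulate (λ s → e (F.suc s))) ∎)
    where
    t : Fin (suc n) → Carrier
    t j = r (e (F.suc j)) * f (tabulate (λ s → e (punchIn (F.suc j) s)))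

  det≈detL : ∀ n (rows : Fin n → X → Carrier) (e : Fin n → X) →
             det R n (λ i j → rows i (e j)) ≈ detL (tabulate rows) (tabulate e)
  det≈detL zero    rows e = refl
  det≈detL (suc n) rows e = begin
    det R (suc n) M
      ≡⟨ proj₂ (det-suc n M) ⟩
    sumR R (map (detTerm n M) (tabulate id))
      ≡⟨ ≡.cong (sumR R) (Lₚ.map-tabulate id (detTerm n M)) ⟩
    sumR R (tabulate (detTerm n M))
      ≈⟨ sumR-tabulate-cong (λ j → trans (reflexive (detTerm≡ n M j))
           (*-cong (reflexive (detSign≡sign n M (toℕ j)))
             (*-congˡ (det≈detL n (λ i → rows (F.suc i)) (λ s → e (punchIn j s)))))) ⟩
    sumR R (tabulate (λ j → sign (toℕ j) * (rows F.zero (e j) *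
      detL (tabulate (λ i → rows (F.suc i))) (tabulate (λ s → e (punchIn j s))))))
      ≈⟨ contract-tabulate n (rows F.zero) (detL (tabulate (λ i → rows (F.suc i)))) e ⟩
    detL (tabulate rows) (tabulate e) ∎
    where
    M : Fin (suc n) → Fin (suc n) → Carrier
    M i j = rows i (e j)

-- Comparisons, ranges, and Pascal's rule for generalised binomial coefficients

≤ᵇ-true : ∀ {m n} → m ℕ.≤ n → (m ≤ᵇ n) ≡ true
≤ᵇ-true m≤n = Equivalence.to 𝔹ₚ.T-≡ (ℕₚ.≤⇒≤ᵇ m≤n)

≤ᵇ-false : ∀ {m n} → n ℕ.< m → (m ≤ᵇ n) ≡ false
≤ᵇ-false {m} {n} n<m with m ≤ᵇ n in eq
... | false = ≡.refl
... | true  = ⊥-elim (ℕₚ.<⇒≱ n<m (ℕₚ.≤ᵇ⇒≤ m n (Equivalence.from 𝔹ₚ.T-≡ eq)))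

range-suc : ∀ n → range 0 (suc n) ≡ range 0 n ++ suc n ∷ []
range-suc n = ≡.trans (≡.cong (map suc) (≡.sym (Lₚ.upTo-∷ʳ n))) (Lₚ.map-++ suc (upTo n) (n ∷ []))

alternate : ℕ → ℤ
alternate zero    = + 1
alternate (suc k) = ℤ.- alternate k

-- The sign function in the definition of binomℤ has no accessible name and is recovered by unification.
-- Unification sees through _◃_ and sign, which are injective in its sense, but not through the product of
-- signs between them; there the monoid solver, run on a monoid whose equality proofs record the operands
-- to which identityʳ was applied, exposes the left factor.
mutual
  binomSign : ℕ → ℕ → ℕ → Sign
  binomSign = _

  binomAbs : ℕ → ℕ → ℕ → ℕ
  binomAbs = _

  binomℤ-◃ : ∀ b k → binomℤ -[1+ b ] (suc k) ≡ binomSign b (suc k) k ◃ binomAbs b (suc k) k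
  binomℤ-◃ b k with suc k
  ... | w = ≡.refl

data Trace (a b : Sign) : Set where
  trace : List Sign → Trace a b

firstOperand : ∀ {a b} → Trace a b → Sign
firstOperand (trace (s ∷ _)) = s
firstOperand (trace [])      = Sign.+

tracing : Monoid _ _
tracing = record
  { Carrier = Sign ; _≈_ = Trace ; _∙_ = S._*_ ; ε = Sign.+
  ; isMonoid = record
    { isSemigroup = record
      { isMagma = record
        { isEquivalence = record
          { refl  = trace []
          ; sym   = λ { (trace l) → trace l }
          ; trans = λ { (trace l) (trace l′) → trace (l ++ l′) } }
        ; ∙-cong = λ { (trace l) (trace l′) → trace (l ++ l′) } }
      ; assoc = λ _ _ _ → trace [] }
    ; identity = (λ _ → trace []) , (λ a → trace (a ∷ [])) } }

binomSign-trace : ∀ b w k → Trace (binomSign b w k) (binomSign b w k)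
binomSign-trace b w k = MonoidSolver.solve tracing

mutual
  binomFactor : ℕ → ℕ → ℕ → ℤ
  binomFactor = _

  sign-binomFactor : ∀ b w k → ℤ.sign (binomFactor b w k) ≡ firstOperand (binomSign-trace b w k)
  sign-binomFactor b w k = ≡.refl

binomFactor≡alternate : ∀ b w k → binomFactor b w k ≡ alternate (suc k)
binomFactor≡alternate b w zero    = ≡.refl
binomFactor≡alternate b w (suc k) = ≡.cong ℤ.-_ (binomFactor≡alternate b w k)

binomℤ-negsuc : ∀ b k → binomℤ -[1+ b ] k ≡ alternate k ℤ.* + ((b ℕ.+ k) C k)
binomℤ-negsuc b zero    = ≡.refl
binomℤ-negsuc b (suc k) =
  ≡.cong (λ s → s ℤ.* + ((b ℕ.+ suc k) C suc k)) (binomFactor≡alternate b (suc k) k)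

binomℤ-pascal : ∀ y k → binomℤ (ℤ.suc y) (suc k) ≡ binomℤ y k ℤ.+ binomℤ y (suc k)
binomℤ-pascal (+ n) k = ≡.cong +_ (≡.sym (nCk+nC[k+1]≡[n+1]C[k+1] n k))
-- Here y = -1 and y + 1 = 0 lie in different branches of the definition. The coefficients of -1 are
-- the signs (-1)^k, so consecutive ones cancel.
binomℤ-pascal -[1+ zero ] k = begin
  + (0 C suc k)
    ≡⟨ ≡.cong +_ (k>n⇒nCk≡0 (ℕ.s≤s (ℕ.z≤n {k}))) ⟩
  + 0
    ≡⟨ cancel (alternate k) ⟩
  alternate k ℤ.* + 1 ℤ.+ ℤ.- alternate k ℤ.* + 1
    ≡⟨ ≡.cong₂ (λ u v → alternate k ℤ.* + u ℤ.+ ℤ.- alternate k ℤ.* + v)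
         (≡.sym (nCn≡1 k)) (≡.sym (nCn≡1 (suc k))) ⟩
  alternate k ℤ.* + (k C k) ℤ.+ ℤ.- alternate k ℤ.* + (suc k C suc k)
    ≡⟨ ≡.cong₂ ℤ._+_ (≡.sym (binomℤ-negsuc 0 k)) (≡.sym (binomℤ-negsuc 0 (suc k))) ⟩
  binomℤ -[1+ 0 ] k ℤ.+ binomℤ -[1+ 0 ] (suc k) ∎
  where
  open ≡.≡-Reasoning
  cancel : ∀ s → + 0 ≡ s ℤ.* + 1 ℤ.+ ℤ.- s ℤ.* + 1
  cancel = ℤSolver.solve-∀
binomℤ-pascal -[1+ suc b ] k = begin
  binomℤ -[1+ b ] (suc k)
    ≡⟨ binomℤ-negsuc b (suc k) ⟩
  ℤ.- alternate k ℤ.* + ((b ℕ.+ suc k) C suc k)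
    ≡⟨ ≡.cong (λ n → ℤ.- alternate k ℤ.* + (n C suc k)) (ℕₚ.+-suc b k) ⟩
  ℤ.- alternate k ℤ.* + q
    ≡⟨ regroup (alternate k) (+ p) (+ q) ⟩
  alternate k ℤ.* + p ℤ.+ ℤ.- alternate k ℤ.* (+ p ℤ.+ + q)
    ≡⟨ ≡.cong (λ n → alternate k ℤ.* + p ℤ.+ ℤ.- alternate k ℤ.* + n)
         (nCk+nC[k+1]≡[n+1]C[k+1] (suc (b ℕ.+ k)) k) ⟩
  alternate k ℤ.* + p ℤ.+ ℤ.- alternate k ℤ.* + (suc (suc (b ℕ.+ k)) C suc k)
    ≡⟨ ≡.cong (λ n → alternate k ℤ.* + p ℤ.+ ℤ.- alternate k ℤ.* + (suc n C suc k))
         (≡.sym (ℕₚ.+-suc b k)) ⟩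
  alternate k ℤ.* + p ℤ.+ ℤ.- alternate k ℤ.* + ((suc b ℕ.+ suc k) C suc k)
    ≡⟨ ≡.cong₂ ℤ._+_ (≡.sym (binomℤ-negsuc (suc b) k)) (≡.sym (binomℤ-negsuc (suc b) (suc k))) ⟩
  binomℤ -[1+ suc b ] k ℤ.+ binomℤ -[1+ suc b ] (suc k) ∎
  where
  open ≡.≡-Reasoning
  p = suc (b ℕ.+ k) C k
  q = suc (b ℕ.+ k) C suc k
  regroup : ∀ s u v → ℤ.- s ℤ.* v ≡ s ℤ.* u ℤ.+ ℤ.- s ℤ.* (u ℤ.+ v)
  regroup = ℤSolver.solve-∀

-- Finite sums, sums over words, and integers in a ring

module Sums {c ℓ : Level} (R : CommutativeRing c ℓ) where
  open CommutativeRing R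
  open RingProperties ring using (-0#≈0#; -‿+-comm)
  open SemiringSolver commutativeSemiring using (solve; _:+_; _:*_; _:=_)
  open SetoidReasoning setoid

  private
    variable
      A B : Set

  -- The last term is split off because every recurrence singles out the largest variable or the
  -- largest entry f + 1.
  ∑ : ℕ → (ℕ → Carrier) → Carrier
  ∑ zero    f = 0#
  ∑ (suc n) f = ∑ n f + f (suc n)

  ∑-cong : ∀ n {f g} → (∀ a → a ℕ.≤ n → f a ≈ g a) → ∑ n f ≈ ∑ n g
  ∑-cong zero    f≈g = refl
  ∑-cong (suc n) f≈g = +-cong (∑-cong n (λ a a≤n → f≈g a (ℕₚ.m≤n⇒m≤1+n a≤n))) (f≈g (suc n) ℕₚ.≤-refl)

  ∑-zero : ∀ n {f} → (∀ a → a ℕ.≤ n → f a ≈ 0#) → ∑ n f ≈ 0#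
  ∑-zero zero    f≈0 = refl
  ∑-zero (suc n) f≈0 = trans (+-cong (∑-zero n (λ a a≤n → f≈0 a (ℕₚ.m≤n⇒m≤1+n a≤n)))
                                     (f≈0 (suc n) ℕₚ.≤-refl)) (+-identityʳ 0#)

  ∑-linear : ∀ n f a g → ∑ n (λ k → f k + a * g k) ≈ ∑ n f + a * ∑ n g
  ∑-linear zero    f a g = sym (trans (+-identityˡ _) (zeroʳ a))
  ∑-linear (suc n) f a g = trans (+-congʳ (∑-linear n f a g))
    (solve 5 (λ p q u v b → (p :+ b :* q) :+ (u :+ b :* v) := (p :+ u) :+ b :* (q :+ v)) refl
      (∑ n f) (∑ n g) (f (suc n)) (g (suc n)) a)

  ∑-scale : ∀ n a g → ∑ n (λ k → a * g k) ≈ a * ∑ n g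
  ∑-scale zero    a g = sym (zeroʳ a)
  ∑-scale (suc n) a g = trans (+-congʳ (∑-scale n a g)) (sym (distribˡ a _ _))

  ∑-+ : ∀ n f g → ∑ n (λ k → f k + g k) ≈ ∑ n f + ∑ n g
  ∑-+ zero    f g = sym (+-identityˡ 0#)
  ∑-+ (suc n) f g = trans (+-congʳ (∑-+ n f g))
    (solve 4 (λ p q u v → (p :+ q) :+ (u :+ v) := (p :+ u) :+ (q :+ v)) refl
      (∑ n f) (∑ n g) (f (suc n)) (g (suc n)))

  ∑-swap : ∀ m n (f : ℕ → ℕ → Carrier) → ∑ m (λ a → ∑ n (f a)) ≈ ∑ n (λ b → ∑ m (λ a → f a b))
  ∑-swap zero    n f = sym (∑-zero n (λ _ _ → refl))
  ∑-swap (suc m) n f = trans (+-congʳ (∑-swap m n f)) (sym (∑-+ n _ (f (suc m))))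

  sumR-++ : ∀ as bs → sumR R (as ++ bs) ≈ sumR R as + sumR R bs
  sumR-++ []       bs = sym (+-identityˡ _)
  sumR-++ (a ∷ as) bs = trans (+-congˡ (sumR-++ as bs)) (sym (+-assoc a _ _))

  sumR-range : ∀ n f → sumR R (map f (range 0 n)) ≈ ∑ n f
  sumR-range zero    f = refl
  sumR-range (suc n) f = begin
    sumR R (map f (range 0 (suc n)))
      ≡⟨ ≡.cong (sumR R ∘ map f) (range-suc n) ⟩
    sumR R (map f (range 0 n ++ suc n ∷ []))
      ≡⟨ ≡.cong (sumR R) (Lₚ.map-++ f (range 0 n) (suc n ∷ [])) ⟩
    sumR R (map f (range 0 n) ++ f (suc n) ∷ [])
      ≈⟨ sumR-++ (map f (range 0 n)) (f (suc n) ∷ []) ⟩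
    sumR R (map f (range 0 n)) + (f (suc n) + 0#)
      ≈⟨ +-cong (sumR-range n f) (+-identityʳ _) ⟩
    ∑ n f + f (suc n) ∎

  sumR-concatMap : ∀ (f : B → Carrier) (g : A → List B) as →
                   sumR R (map f (concatMap g as)) ≈ sumR R (map (λ a → sumR R (map f (g a))) as)
  sumR-concatMap f g []       = refl
  sumR-concatMap f g (a ∷ as) = begin
    sumR R (map f (g a ++ concatMap g as))
      ≡⟨ ≡.cong (sumR R) (Lₚ.map-++ f (g a) (concatMap g as)) ⟩
    sumR R (map f (g a) ++ map f (concatMap g as))
      ≈⟨ sumR-++ (map f (g a)) _ ⟩
    sumR R (map f (g a)) + sumR R (map f (concatMap g as))
      ≈⟨ +-congˡ (sumR-concatMap f g as) ⟩
    sumR R (map f (g a)) + sumR R (map (λ b → sumR R (map f (g b))) as) ∎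

  when : Bool → Carrier → Carrier
  when b a = if b then a else 0#

  when-cong : ∀ b {u v} → u ≈ v → when b u ≈ when b v
  when-cong true  u≈v = u≈v
  when-cong false u≈v = refl

  when-linear : ∀ b y u a v → when b (y * (u + a * v)) ≈ when b (y * u) + a * when b (y * v)
  when-linear true  y u a v = solve 4 (λ y u a v → y :* (u :+ a :* v) := y :* u :+ a :* (y :* v)) refl y u a v
  when-linear false y u a v = sym (trans (+-identityˡ _) (zeroʳ a))

  sumR-filter : ∀ (p : B → Bool) (f : B → Carrier) (g : A → B) as →
    sumR R (map f (foldr (λ a bs → if p (g a) then g a ∷ bs else bs) [] as)) ≈
    sumR R (map (λ a → when (p (g a)) (f (g a))) as)
  sumR-filter p f g []       = refl
  sumR-filter p f g (a ∷ as) with p (g a)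
  ... | true  = +-congˡ (sumR-filter p f g as)
  ... | false = trans (sumR-filter p f g as) (sym (+-identityˡ _))

  sumR-filter-map : ∀ (p : A → Bool) (f : A → Carrier) as →
    sumR R (foldr (λ a bs → if p a then f a ∷ bs else bs) [] as) ≈
    sumR R (map (λ a → when (p a) (f a)) as)
  sumR-filter-map p f []       = refl
  sumR-filter-map p f (a ∷ as) with p a
  ... | true  = +-congˡ (sumR-filter-map p f as)
  ... | false = trans (sumR-filter-map p f as) (sym (+-identityˡ _))

  wordSum : ℕ → ℕ → (List ℕ → Carrier) → Carrier
  wordSum m zero    f = f []
  wordSum m (suc k) f = ∑ m (λ a → wordSum m k (λ w → f (a ∷ w)))

  sumR-words : ∀ m k f → sumR R (map f (words m k)) ≈ wordSum m k f
  sumR-words m zero    f = +-identityʳ _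
  sumR-words m (suc k) f = begin
    sumR R (map f (concatMap (λ a → map (a ∷_) (words m k)) (range 0 m)))
      ≈⟨ sumR-concatMap f (λ a → map (a ∷_) (words m k)) (range 0 m) ⟩
    sumR R (map (λ a → sumR R (map f (map (a ∷_) (words m k)))) (range 0 m))
      ≈⟨ sumR-range m _ ⟩
    ∑ m (λ a → sumR R (map f (map (a ∷_) (words m k))))
      ≈⟨ ∑-cong m (λ a _ → trans
           (reflexive (≡.cong (sumR R) (≡.sym (Lₚ.map-∘ (words m k)))))
           (sumR-words m k (λ w → f (a ∷ w)))) ⟩
    ∑ m (λ a → wordSum m k (λ w → f (a ∷ w))) ∎

  wordSum-cong : ∀ m k {f g} → (∀ w → f w ≈ g w) → wordSum m k f ≈ wordSum m k g
  wordSum-cong m zero    f≈g = f≈g []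
  wordSum-cong m (suc k) f≈g = ∑-cong m (λ a _ → wordSum-cong m k (λ w → f≈g (a ∷ w)))

  wordSum-scale : ∀ m k a f → wordSum m k (λ w → a * f w) ≈ a * wordSum m k f
  wordSum-scale m zero    a f = refl
  wordSum-scale m (suc k) a f =
    trans (∑-cong m (λ b _ → wordSum-scale m k a (λ w → f (b ∷ w)))) (∑-scale m a _)

  wordSum-zero : ∀ m k → wordSum m k (λ _ → 0#) ≈ 0#
  wordSum-zero m zero    = refl
  wordSum-zero m (suc k) = ∑-zero m (λ _ _ → wordSum-zero m k)

  wordSum-when : ∀ m k b f → wordSum m k (λ w → when b (f w)) ≈ when b (wordSum m k f)
  wordSum-when m k true  f = refl
  wordSum-when m k false f = wordSum-zero m k

  natR-⊖ : ∀ m n → intR R (m ⊖ n) ≈ natR R m - natR R n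
  natR-⊖ m       zero    = sym (trans (+-congˡ -0#≈0#) (+-identityʳ _))
  natR-⊖ zero    (suc n) = sym (+-identityˡ _)
  natR-⊖ (suc m) (suc n) = begin
    intR R (suc m ⊖ suc n)           ≡⟨ ≡.cong (intR R) (ℤₚ.[1+m]⊖[1+n]≡m⊖n m n) ⟩
    intR R (m ⊖ n)                   ≈⟨ natR-⊖ m n ⟩
    u - v                            ≈⟨ sym (+-identityˡ _) ⟩
    0# + (u - v)                     ≈⟨ +-congʳ (sym (-‿inverseʳ 1#)) ⟩
    (1# - 1#) + (u - v)
      ≈⟨ solve 4 (λ a b u v → (a :+ b) :+ (u :+ v) := (a :+ u) :+ (b :+ v)) refl 1# (- 1#) u (- v) ⟩
    (1# + u) + (- 1# - v)            ≈⟨ +-congˡ (-‿+-comm 1# v) ⟩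
    (1# + u) - (1# + v)              ∎
    where
    u = natR R m
    v = natR R n

  natR-+ : ∀ m n → natR R (m ℕ.+ n) ≈ natR R m + natR R n
  natR-+ zero    n = sym (+-identityˡ _)
  natR-+ (suc m) n = trans (+-congˡ (natR-+ m n)) (sym (+-assoc 1# _ _))

  intR-+ : ∀ a b → intR R (a ℤ.+ b) ≈ intR R a + intR R b
  intR-+ (+ m)    (+ n)    = natR-+ m n
  intR-+ (+ m)    -[1+ n ] = natR-⊖ m (suc n)
  intR-+ -[1+ m ] (+ n)    = trans (natR-⊖ n (suc m)) (+-comm _ _)
  intR-+ -[1+ m ] -[1+ n ] = begin
    - natR R (suc (suc (m ℕ.+ n)))          ≡⟨ ≡.cong (λ k → - natR R (suc k)) (≡.sym (ℕₚ.+-suc m n)) ⟩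
    - natR R (suc m ℕ.+ suc n)              ≈⟨ -‿cong (natR-+ (suc m) (suc n)) ⟩
    - (natR R (suc m) + natR R (suc n))     ≈⟨ sym (-‿+-comm _ _) ⟩
    - natR R (suc m) - natR R (suc n)       ∎

-- Complete homogeneous polynomials and their images under the powers of φ

module Homogeneous {c ℓ : Level} (R : CommutativeRing c ℓ) (x : ℕ → CommutativeRing.Carrier R) where
  open CommutativeRing R
  open SemiringSolver commutativeSemiring using (solve; _:+_; _:*_; _:=_)
  open SetoidReasoning setoid
  open Sums R

  h : ℕ → ℕ → Carrier
  h f k = hR R f x (+ k)

  -- The complete homogeneous polynomial in the variables from `x lo` to `x f`: once a letter has
  -- been read, sortedness restricts the rest of the word only through this lower bound. As letters
  -- start at 1, `lo` = 0 is no restriction.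
  hFrom : ℕ → ℕ → ℕ → Carrier
  hFrom lo f k = wordSum f k (λ w → when (sortedᵇ (lo ∷ w)) (prodR R (map x w)))

  h≈hFrom : ∀ f k → h f k ≈ hFrom 0 f k
  h≈hFrom f k = begin
    h f k
      ≈⟨ sumR-filter-map sortedᵇ (λ w → prodR R (map x w)) (words f k) ⟩
    sumR R (map (λ w → when (sortedᵇ w) (prodR R (map x w))) (words f k))
      ≈⟨ sumR-words f k _ ⟩
    wordSum f k (λ w → when (sortedᵇ w) (prodR R (map x w)))
      ≈⟨ wordSum-cong f k (λ w → reflexive (≡.cong (λ b → when b (prodR R (map x w))) (sorted-0∷ w))) ⟩
    hFrom 0 f k ∎
    where
    sorted-0∷ : ∀ w → sortedᵇ w ≡ sortedᵇ (0 ∷ w)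
    sorted-0∷ []      = ≡.refl
    sorted-0∷ (_ ∷ _) = ≡.refl

  hFrom-suc : ∀ lo f k → hFrom lo f (suc k) ≈ ∑ f (λ a → when (lo ≤ᵇ a) (x a * hFrom a f k))
  hFrom-suc lo f k = ∑-cong f (λ a _ → begin
    wordSum f k (λ w → when ((lo ≤ᵇ a) ∧ sortedᵇ (a ∷ w)) (x a * prodR R (map x w)))
      ≈⟨ wordSum-cong f k (λ w → when-∧ (lo ≤ᵇ a) (sortedᵇ (a ∷ w)) (x a) (prodR R (map x w))) ⟩
    wordSum f k (λ w → when (lo ≤ᵇ a) (x a * when (sortedᵇ (a ∷ w)) (prodR R (map x w))))
      ≈⟨ wordSum-when f k (lo ≤ᵇ a) _ ⟩
    when (lo ≤ᵇ a) (wordSum f k (λ w → x a * when (sortedᵇ (a ∷ w)) (prodR R (map x w))))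
      ≈⟨ when-cong (lo ≤ᵇ a) (wordSum-scale f k (x a) _) ⟩
    when (lo ≤ᵇ a) (x a * hFrom a f k) ∎)
    where
    when-∧ : ∀ b b′ u v → when (b ∧ b′) (u * v) ≈ when b (u * when b′ v)
    when-∧ true  true  u v = refl
    when-∧ true  false u v = sym (zeroʳ u)
    when-∧ false _     u v = refl

  hFrom-empty : ∀ f k → hFrom (suc f) f (suc k) ≈ 0#
  hFrom-empty f k = trans (hFrom-suc (suc f) f k)
    (∑-zero f (λ a a≤f → reflexive (≡.cong (λ b → when b (x a * hFrom a f k)) (≤ᵇ-false (ℕ.s≤s a≤f)))))

  -- The recurrence takes away a last letter f + 1, but words are read from the front; so the first
  -- letter is split off and the induction is on the degree, for all `lo` at once. For `lo` beyond f
  -- + 1 it fails in degree 1, since the polynomial of degree 0 is 1 even without variables.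
  hFrom-newVariable : ∀ k lo f → lo ℕ.≤ suc f →
                      hFrom lo (suc f) (suc k) ≈ hFrom lo f (suc k) + x (suc f) * hFrom lo (suc f) k
  hFrom-newVariable zero lo f lo≤ = begin
    hFrom lo (suc f) 1
      ≈⟨ hFrom-suc lo (suc f) 0 ⟩
    ∑ f (λ a → when (lo ≤ᵇ a) (x a * 1#)) + when (lo ≤ᵇ suc f) (x (suc f) * 1#)
      ≈⟨ +-cong (sym (hFrom-suc lo f 0)) (reflexive (≡.cong (λ b → when b _) (≤ᵇ-true lo≤))) ⟩
    hFrom lo f 1 + x (suc f) * 1# ∎
  hFrom-newVariable (suc k) lo f lo≤ = begin
    hFrom lo (suc f) (suc (suc k))
      ≈⟨ hFrom-suc lo (suc f) (suc k) ⟩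
    ∑ f (λ a → when (lo ≤ᵇ a) (x a * hFrom a (suc f) (suc k))) + top (hFrom (suc f) (suc f) (suc k))
      ≈⟨ +-cong (∑-cong f (λ a a≤f → trans
                   (when-cong (lo ≤ᵇ a) (*-congˡ (hFrom-newVariable k a f (ℕₚ.m≤n⇒m≤1+n a≤f))))
                   (when-linear (lo ≤ᵇ a) (x a) _ y _)))
                -- After a first letter f + 1 no letter up to f may follow, so that part contributes
                -- 0.
                (when-cong (lo ≤ᵇ suc f) (*-congˡ (trans (hFrom-newVariable k (suc f) f ℕₚ.≤-refl)
                   (+-congʳ (hFrom-empty f k))))) ⟩
    ∑ f (λ a → when (lo ≤ᵇ a) (x a * hFrom a f (suc k)) + y * when (lo ≤ᵇ a) (x a * hFrom a (suc f) k))
      + top (0# + y * hFrom (suc f) (suc f) k)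
      ≈⟨ +-cong (∑-linear f _ y _)
                (when-linear (lo ≤ᵇ suc f) y 0# y _) ⟩
    (∑ f (λ a → when (lo ≤ᵇ a) (x a * hFrom a f (suc k)))
      + y * ∑ f (λ a → when (lo ≤ᵇ a) (x a * hFrom a (suc f) k)))
      + (top 0# + y * top (hFrom (suc f) (suc f) k))
      ≈⟨ +-congˡ (+-congʳ (top-zero (lo ≤ᵇ suc f))) ⟩
    (∑ f (λ a → when (lo ≤ᵇ a) (x a * hFrom a f (suc k)))
      + y * ∑ f (λ a → when (lo ≤ᵇ a) (x a * hFrom a (suc f) k)))
      + (0# + y * top (hFrom (suc f) (suc f) k))
      ≈⟨ regroup _ _ _ ⟩
    ∑ f (λ a → when (lo ≤ᵇ a) (x a * hFrom a f (suc k)))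
      + y * (∑ f (λ a → when (lo ≤ᵇ a) (x a * hFrom a (suc f) k)) + top (hFrom (suc f) (suc f) k))
      ≈⟨ +-cong (sym (hFrom-suc lo f (suc k))) (*-congˡ (sym (hFrom-suc lo (suc f) k))) ⟩
    hFrom lo f (suc (suc k)) + y * hFrom lo (suc f) (suc k) ∎
    where
    y = x (suc f)
    top : Carrier → Carrier
    top u = when (lo ≤ᵇ suc f) (y * u)
    top-zero : ∀ b → when b (y * 0#) ≈ 0#
    top-zero true  = zeroʳ y
    top-zero false = refl
    regroup : ∀ u v w → (u + y * v) + (0# + y * w) ≈ u + y * (v + w)
    regroup u v w = begin
      (u + y * v) + (0# + y * w)  ≈⟨ +-congˡ (+-identityˡ _) ⟩
      (u + y * v) + y * w         ≈⟨ +-assoc u _ _ ⟩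
      u + (y * v + y * w)         ≈⟨ +-congˡ (sym (distribˡ y v w)) ⟩
      u + y * (v + w)             ∎

  h-newVariable : ∀ f k → h (suc f) (suc k) ≈ h f (suc k) + x (suc f) * h (suc f) k
  h-newVariable f k = begin
    h (suc f) (suc k)                                    ≈⟨ h≈hFrom (suc f) (suc k) ⟩
    hFrom 0 (suc f) (suc k)                              ≈⟨ hFrom-newVariable k 0 f ℕ.z≤n ⟩
    hFrom 0 f (suc k) + x (suc f) * hFrom 0 (suc f) k    ≈⟨ +-cong (sym (h≈hFrom f (suc k)))
                                                              (*-congˡ (sym (h≈hFrom (suc f) k))) ⟩
    h f (suc k) + x (suc f) * h (suc f) k                ∎

  h-zero : ∀ f → h f 0 ≈ 1#
  h-zero f = +-identityʳ 1#

  h-noVariables : ∀ k → h 0 (suc k) ≈ 0#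
  h-noVariables k = h≈hFrom 0 (suc k)

  -- The coefficients of a product of two power series. With H(t) the generating function of the
  -- `h f k`, φ^l h_k is the coefficient of t^k in (1 - t)^(-l) H(t); each of the two recurrences
  -- concerns one of the factors.
  convolve : (ℕ → Carrier) → (ℕ → Carrier) → ℕ → Carrier
  convolve a g zero    = a 0 * g 0
  convolve a g (suc k) = a 0 * g (suc k) + convolve (λ r → a (suc r)) g k

  -- The coefficient of t^r in (1 - t)^(-l).
  φcoeff : ℤ → ℕ → Carrier
  φcoeff l r = intR R (binomℤ (l ℤ.+ + r ℤ.- + 1) r)

  -- Compare coefficients in (1 - t)^(-(l+1)) = t (1 - t)^(-(l+1)) + (1 - t)^(-l); for the binomials
  -- this is Pascal's rule at y = l + r.
  φcoeff-suc : ∀ l r → φcoeff (ℤ.suc l) (suc r) ≈ φcoeff (ℤ.suc l) r + φcoeff l (suc r)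
  φcoeff-suc l r = begin
    intR R (binomℤ (ℤ.suc l ℤ.+ + suc r ℤ.- + 1) (suc r))
      ≡⟨ ≡.cong (λ y → intR R (binomℤ y (suc r))) (eq₁ l (+ r)) ⟩
    intR R (binomℤ (ℤ.suc (l ℤ.+ + r)) (suc r))
      ≡⟨ ≡.cong (intR R) (binomℤ-pascal (l ℤ.+ + r) r) ⟩
    intR R (binomℤ (l ℤ.+ + r) r ℤ.+ binomℤ (l ℤ.+ + r) (suc r))
      ≈⟨ intR-+ (binomℤ (l ℤ.+ + r) r) _ ⟩
    intR R (binomℤ (l ℤ.+ + r) r) + intR R (binomℤ (l ℤ.+ + r) (suc r))
      ≡⟨ ≡.cong₂ (λ y z → intR R (binomℤ y r) + intR R (binomℤ z (suc r))) (eq₂ l (+ r)) (eq₃ l (+ r)) ⟩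
    φcoeff (ℤ.suc l) r + φcoeff l (suc r) ∎
    where
    eq₁ : ∀ l r → (+ 1 ℤ.+ l) ℤ.+ (+ 1 ℤ.+ r) ℤ.- + 1 ≡ + 1 ℤ.+ (l ℤ.+ r)
    eq₁ = ℤSolver.solve-∀
    eq₂ : ∀ l r → l ℤ.+ r ≡ (+ 1 ℤ.+ l) ℤ.+ r ℤ.- + 1
    eq₂ = ℤSolver.solve-∀
    eq₃ : ∀ l r → l ℤ.+ r ≡ l ℤ.+ (+ 1 ℤ.+ r) ℤ.- + 1
    eq₃ = ℤSolver.solve-∀

  φcoeff-zero : ∀ l → φcoeff l 0 ≈ 1#
  φcoeff-zero l = trans (reflexive (≡.cong (intR R) (binom-0 (l ℤ.+ + 0 ℤ.- + 1)))) (+-identityʳ 1#)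
    where
    binom-0 : ∀ y → binomℤ y 0 ≡ + 1
    binom-0 (+ n)    = ≡.refl
    binom-0 -[1+ n ] = ≡.refl

  convolve-linear : ∀ {a b c : ℕ → Carrier} g k → (∀ r → a r ≈ b r + c r) →
                    convolve a g k ≈ convolve b g k + convolve c g k
  convolve-linear g zero    a≈ = trans (*-congʳ (a≈ 0)) (distribʳ (g 0) _ _)
  convolve-linear {a} {b} {c} g (suc k) a≈ =
    trans (+-cong (*-congʳ (a≈ 0)) (convolve-linear g k (λ r → a≈ (suc r))))
      (solve 5 (λ p q u v w → (p :+ q) :* u :+ (v :+ w) := (p :* u :+ v) :+ (q :* u :+ w)) refl
        (b 0) (c 0) (g (suc k)) (convolve (λ r → b (suc r)) g k) (convolve (λ r → c (suc r)) g k))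

  -- The new variable only enters the second factor, whose series is divided by 1 - x_(f+1) t. The
  -- last summand, with h_0, needs no correction because h_0 = 1 for any number of variables.
  convolve-newVariable : ∀ a f k →
    convolve a (h (suc f)) (suc k) ≈ convolve a (h f) (suc k) + x (suc f) * convolve a (h (suc f)) k
  convolve-newVariable a f zero = begin
    a 0 * h (suc f) 1 + a 1 * h (suc f) 0
      ≈⟨ +-cong (*-congˡ (h-newVariable f 0)) (*-congˡ (trans (h-zero (suc f)) (sym (h-zero f)))) ⟩
    a 0 * (h f 1 + x (suc f) * h (suc f) 0) + a 1 * h f 0
      ≈⟨ solve 6 (λ p q u v w y → p :* (u :+ y :* v) :+ q :* w := (p :* u :+ q :* w) :+ y :* (p :* v)) refl
           (a 0) (a 1) (h f 1) (h (suc f) 0) (h f 0) (x (suc f)) ⟩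
    a 0 * h f 1 + a 1 * h f 0 + x (suc f) * (a 0 * h (suc f) 0) ∎
  convolve-newVariable a f (suc k) =
    trans (+-cong (*-congˡ (h-newVariable f (suc k))) (convolve-newVariable (λ r → a (suc r)) f k))
      (solve 6 (λ p u v s t y → p :* (u :+ y :* v) :+ (s :+ y :* t) := (p :* u :+ s) :+ y :* (p :* v :+ t)) refl
        (a 0) (h f (suc (suc k))) (h (suc f) (suc k)) (convolve (λ r → a (suc r)) (h f) (suc k))
        (convolve (λ r → a (suc r)) (h (suc f)) k) (x (suc f)))

  sumR-applyUpTo-cong : ∀ n {f g : ℕ → Carrier} → (∀ r → f r ≈ g r) →
                        sumR R (applyUpTo f n) ≈ sumR R (applyUpTo g n)
  sumR-applyUpTo-cong zero    f≈g = refl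
  sumR-applyUpTo-cong (suc n) f≈g = +-cong (f≈g 0) (sumR-applyUpTo-cong n (λ r → f≈g (suc r)))

  sumR≈convolve : ∀ f a k → sumR R (applyUpTo (λ r → a r * hR R f x (+ k ℤ.- + r)) (suc k)) ≈ convolve a (h f) k
  sumR≈convolve f a zero    = +-identityʳ _
  sumR≈convolve f a (suc k) = +-cong
    (*-congˡ (reflexive (≡.cong (λ n → hR R f x (+ n)) (ℕₚ.+-identityʳ (suc k)))))
    (trans (sumR-applyUpTo-cong (suc k) (λ r →
             *-congˡ {a (suc r)} (reflexive (≡.cong (hR R f x) (cancel (+ k) (+ r))))))
           (sumR≈convolve f (λ r → a (suc r)) k))
    where
    cancel : ∀ k r → (+ 1 ℤ.+ k) ℤ.- (+ 1 ℤ.+ r) ≡ k ℤ.- r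
    cancel = ℤSolver.solve-∀

  φh≈convolve : ∀ f l k → φhR R f x l (+ k) ≈ convolve (φcoeff l) (h f) k
  φh≈convolve f l k = trans (reflexive (≡.cong (sumR R) (Lₚ.map-upTo _ (suc k)))) (sumR≈convolve f (φcoeff l) k)

  φh-zero : ∀ f l → φhR R f x l (+ 0) ≈ 1#
  φh-zero f l = trans (φh≈convolve f l 0)
    (trans (*-cong (φcoeff-zero l) (h-zero f)) (*-identityˡ 1#))

  φh-newVariable : ∀ f l k → φhR R (suc f) x l (ℤ.suc k) ≈
                   φhR R f x l (ℤ.suc k) + x (suc f) * φhR R (suc f) x l k
  φh-newVariable f l (+ k) = begin
    φhR R (suc f) x l (+ suc k)
      ≈⟨ φh≈convolve (suc f) l (suc k) ⟩
    convolve (φcoeff l) (h (suc f)) (suc k)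
      ≈⟨ convolve-newVariable (φcoeff l) f k ⟩
    convolve (φcoeff l) (h f) (suc k) + x (suc f) * convolve (φcoeff l) (h (suc f)) k
      ≈⟨ +-cong (sym (φh≈convolve f l (suc k))) (*-congˡ (sym (φh≈convolve (suc f) l k))) ⟩
    φhR R f x l (+ suc k) + x (suc f) * φhR R (suc f) x l (+ k) ∎
  -- In degree 0 both sides are 1, because the term of degree -1 is 0. Having the recurrence for
  -- every integer degree makes it valid for all matrix entries.
  φh-newVariable f l -[1+ zero ] =
    trans (trans (φh-zero (suc f) l) (sym (φh-zero f l)))
          (sym (trans (+-congˡ (zeroʳ _)) (+-identityʳ _)))
  φh-newVariable f l -[1+ suc k ] = sym (trans (+-congˡ (zeroʳ _)) (+-identityʳ _))

  -- Applying φ^(l+1) to φ^(-1) h_(k+1) = h_(k+1) - h_k gives the rule; on generating functions it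
  -- is multiplication by 1 - t.
  φh-pascal : ∀ f l k → φhR R f x (ℤ.suc l) (ℤ.suc k) ≈
              φhR R f x (ℤ.suc l) k + φhR R f x l (ℤ.suc k)
  φh-pascal f l (+ k) = begin
    φhR R f x (ℤ.suc l) (+ suc k)
      ≈⟨ φh≈convolve f (ℤ.suc l) (suc k) ⟩
    φcoeff (ℤ.suc l) 0 * h f (suc k) + convolve (λ r → φcoeff (ℤ.suc l) (suc r)) (h f) k
      ≈⟨ +-cong (*-congʳ (trans (φcoeff-zero (ℤ.suc l)) (sym (φcoeff-zero l))))
                (convolve-linear (h f) k (φcoeff-suc l)) ⟩
    φcoeff l 0 * h f (suc k) + (convolve (φcoeff (ℤ.suc l)) (h f) k + convolve (λ r → φcoeff l (suc r)) (h f) k)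
      ≈⟨ solve 3 (λ u v w → u :+ (v :+ w) := v :+ (u :+ w)) refl _ _ _ ⟩
    convolve (φcoeff (ℤ.suc l)) (h f) k + convolve (φcoeff l) (h f) (suc k)
      ≈⟨ +-cong (sym (φh≈convolve f (ℤ.suc l) k)) (sym (φh≈convolve f l (suc k))) ⟩
    φhR R f x (ℤ.suc l) (+ k) + φhR R f x l (+ suc k) ∎
  φh-pascal f l -[1+ zero ] =
    trans (trans (φh-zero f (ℤ.suc l)) (sym (φh-zero f l))) (sym (+-identityˡ _))
  φh-pascal f l -[1+ suc k ] = sym (+-identityˡ _)

  convolve-noVariables : ∀ a k → convolve a (h 0) k ≈ a k
  convolve-noVariables a zero    = trans (*-congˡ (h-zero 0)) (*-identityʳ _)
  convolve-noVariables a (suc k) = begin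
    a 0 * h 0 (suc k) + convolve (λ r → a (suc r)) (h 0) k
      ≈⟨ +-cong (trans (*-congˡ (h-noVariables k)) (zeroʳ _)) (convolve-noVariables (λ r → a (suc r)) k) ⟩
    0# + a (suc k)  ≈⟨ +-identityˡ _ ⟩
    a (suc k)       ∎

  -- Without variables, φ^(-d) h_k is the coefficient of t^k in (1 - t)^d.
  φh-noVariables : ∀ d k → d ℕ.< k → φhR R 0 x (ℤ.- + d) (+ k) ≈ 0#
  φh-noVariables d (suc k) (ℕ.s≤s d≤k) = begin
    φhR R 0 x (ℤ.- + d) (+ suc k)
      ≈⟨ trans (φh≈convolve 0 (ℤ.- + d) (suc k)) (convolve-noVariables (φcoeff (ℤ.- + d)) (suc k)) ⟩
    intR R (binomℤ (ℤ.- + d ℤ.+ + suc k ℤ.- + 1) (suc k))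
      ≡⟨ ≡.cong (λ y → intR R (binomℤ y (suc k)))
           (≡.trans (eq (+ d) (+ k)) (≡.trans (ℤₚ.m-n≡m⊖n k d) (ℤₚ.⊖-≥ d≤k))) ⟩
    natR R ((k ℕ.∸ d) C suc k)
      ≡⟨ ≡.cong (natR R) (k>n⇒nCk≡0 (ℕ.s≤s (ℕₚ.m∸n≤m k d))) ⟩
    0# ∎
    where
    eq : ∀ d k → ℤ.- d ℤ.+ (+ 1 ℤ.+ k) ℤ.- + 1 ≡ k ℤ.- d
    eq = ℤSolver.solve-∀

-- Shapes, rows with bounds, and column labels

Descending : ℕ → List ℕ → Set
Descending b []      = ⊤
Descending b (a ∷ l) = a ℕ.≤ b × Descending a l

descending-mono : ∀ l {a b} → a ℕ.≤ b → Descending a l → Descending b l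
descending-mono []      a≤b _       = tt
descending-mono (_ ∷ _) a≤b (p , q) = ℕₚ.≤-trans p a≤b , q

Row : Set
Row = ℕ × ℕ × ℕ

-- (i , a , f) stands for row i of length a with entries at most f.
rowsFrom : ℕ → ℕ → List ℕ → List Row
rowsFrom i f []      = []
rowsFrom i f (a ∷ l) = (i , a , f) ∷ rowsFrom (suc i) f l

-- Deletes column c + 1 from the rows of length c + 1 at the top of a partition.
trim : ℕ → List ℕ → List ℕ
trim c []      = []
trim c (a ∷ l) with a ℕ.≟ suc c
... | yes _ = c ∷ trim c l
... | no  _ = a ∷ l

upFrom : ℕ → ℕ → List ℕ
upFrom a zero    = []
upFrom a (suc n) = a ∷ upFrom (suc a) n

All-upFrom : ∀ {p} {P : ℕ → Set p} a n → (∀ j → a ℕ.≤ j → j ℕ.< a ℕ.+ n → P j) → All P (upFrom a n)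
All-upFrom a zero    p = []
All-upFrom a (suc n) p =
  p a ℕₚ.≤-refl (ℕₚ.m<m+n a ℕₚ.0<1+n) ∷
  All-upFrom (suc a) n (λ j a<j j< → p j (ℕₚ.<⇒≤ a<j) (≡.subst (j ℕ.<_) (≡.sym (ℕₚ.+-suc a n)) j<))

upFrom-+ : ∀ a m n → upFrom a (m ℕ.+ n) ≡ upFrom a m ++ upFrom (a ℕ.+ m) n
upFrom-+ a zero    n = ≡.cong (λ b → upFrom b n) (≡.sym (ℕₚ.+-identityʳ a))
upFrom-+ a (suc m) n = ≡.cong (a ∷_) (≡.trans (upFrom-+ (suc a) m n)
  (≡.cong (λ b → upFrom (suc a) m ++ upFrom b n) (≡.sym (ℕₚ.+-suc a m))))

length-upFrom : ∀ a n → length (upFrom a n) ≡ n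
length-upFrom a zero    = ≡.refl
length-upFrom a (suc n) = ≡.cong suc (length-upFrom (suc a) n)

-- The recursion for the determinant

module JacobiTrudi {c ℓ : Level} (R : CommutativeRing c ℓ) (x : ℕ → CommutativeRing.Carrier R)
  (mu : List ℕ) where
  open CommutativeRing R
  open SetoidReasoning setoid
  open Determinants R
  open Homogeneous R x

  rowVec : ℕ → ℕ → ℤ → ℕ → Carrier
  rowVec f i z j = φhR R f x (+ i ℤ.- + j) (z ℤ.- + part mu j ℤ.+ + j)

  vec : Row → ℕ → Carrier
  vec (i , a , f) = rowVec f i (+ a ℤ.- + i)

  rowVec-newVariable : ∀ f i z j →
    rowVec (suc f) i z j ≈ rowVec f i z j + x (suc f) * rowVec (suc f) i (z ℤ.- + 1) j
  rowVec-newVariable f i z j = begin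
    φhR R (suc f) x l (z ℤ.- + part mu j ℤ.+ + j)
      ≡⟨ ≡.cong (φhR R (suc f) x l) eq ⟩
    φhR R (suc f) x l (ℤ.suc k)
      ≈⟨ φh-newVariable f l k ⟩
    φhR R f x l (ℤ.suc k) + x (suc f) * φhR R (suc f) x l k
      ≡⟨ ≡.cong (λ y → φhR R f x l y + x (suc f) * φhR R (suc f) x l k) (≡.sym eq) ⟩
    φhR R f x l (z ℤ.- + part mu j ℤ.+ + j) + x (suc f) * φhR R (suc f) x l k ∎
    where
    l = + i ℤ.- + j
    k = z ℤ.- + 1 ℤ.- + part mu j ℤ.+ + j
    lemma : ∀ z p j → z ℤ.- p ℤ.+ j ≡ + 1 ℤ.+ (z ℤ.- + 1 ℤ.- p ℤ.+ j)
    lemma = ℤSolver.solve-∀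
    eq : z ℤ.- + part mu j ℤ.+ + j ≡ ℤ.suc k
    eq = lemma z (+ part mu j) (+ j)

  rowVec-pascal : ∀ f i z j →
    rowVec f (suc i) z j ≈ rowVec f (suc i) (z ℤ.- + 1) j + 1# * rowVec f i z j
  rowVec-pascal f i z j = begin
    φhR R f x (+ suc i ℤ.- + j) (z ℤ.- + part mu j ℤ.+ + j)
      ≡⟨ ≡.cong₂ (φhR R f x) (eqₗ (+ i) (+ j)) eq ⟩
    φhR R f x (ℤ.suc l) (ℤ.suc k)
      ≈⟨ φh-pascal f l k ⟩
    φhR R f x (ℤ.suc l) k + φhR R f x l (ℤ.suc k)
      ≡⟨ ≡.cong₂ (λ y w → φhR R f x y k + φhR R f x l w) (≡.sym (eqₗ (+ i) (+ j))) (≡.sym eq) ⟩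
    rowVec f (suc i) (z ℤ.- + 1) j + rowVec f i z j
      ≈⟨ +-congˡ (sym (*-identityˡ _)) ⟩
    rowVec f (suc i) (z ℤ.- + 1) j + 1# * rowVec f i z j ∎
    where
    l = + i ℤ.- + j
    k = z ℤ.- + 1 ℤ.- + part mu j ℤ.+ + j
    eqₗ : ∀ i j → (+ 1 ℤ.+ i) ℤ.- j ≡ + 1 ℤ.+ (i ℤ.- j)
    eqₗ = ℤSolver.solve-∀
    lemma : ∀ z p j → z ℤ.- p ℤ.+ j ≡ + 1 ℤ.+ (z ℤ.- + 1 ℤ.- p ℤ.+ j)
    lemma = ℤSolver.solve-∀
    eq : z ℤ.- + part mu j ℤ.+ + j ≡ ℤ.suc k
    eq = lemma z (+ part mu j) (+ j)

  vec-newVariable : ∀ f i c j →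
    vec (i , suc c , suc f) j ≈ vec (i , suc c , f) j + x (suc f) * vec (i , c , suc f) j
  vec-newVariable f i c j = trans (rowVec-newVariable f i (+ suc c ℤ.- + i) j)
    (+-congˡ (*-congˡ (reflexive (≡.cong (λ z → rowVec (suc f) i z j) (lemma (+ c) (+ i))))))
    where
    lemma : ∀ c i → (+ 1 ℤ.+ c) ℤ.- i ℤ.- + 1 ≡ c ℤ.- i
    lemma = ℤSolver.solve-∀

  -- Row i + 1 of length c + 1 and row i of length c both have z = c - i, so the second recurrence
  -- at this z compares exactly these two rows.
  vec-pascal : ∀ f i c j →
    vec (suc i , suc c , f) j ≈ vec (suc i , c , f) j + 1# * vec (i , c , f) j
  vec-pascal f i c j = trans (rowVec-pascal f i (+ suc c ℤ.- + suc i) j)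
    (+-cong (reflexive (≡.cong (λ z → rowVec f (suc i) z j) (lemma₁ (+ c) (+ i))))
            (*-congˡ (reflexive (≡.cong (λ z → rowVec f i z j) (lemma₂ (+ c) (+ i))))))
    where
    lemma₁ : ∀ c i → (+ 1 ℤ.+ c) ℤ.- (+ 1 ℤ.+ i) ℤ.- + 1 ≡ c ℤ.- (+ 1 ℤ.+ i)
    lemma₁ = ℤSolver.solve-∀
    lemma₂ : ∀ c i → (+ 1 ℤ.+ c) ℤ.- (+ 1 ℤ.+ i) ≡ c ℤ.- i
    lemma₂ = ℤSolver.solve-∀

  -- The degree is negative. The number `r` need not be the row index i: the row with λ_i lowered
  -- from b to b - 1 is written with a = b and r = i + 1, which also covers b = 0.
  rowVec-vanish : ∀ f i a r j → a ℕ.+ j ℕ.< r ℕ.+ part mu j → rowVec f i (+ a ℤ.- + r) j ≈ 0#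
  rowVec-vanish f i a r j lt = begin
    φhR R f x (+ i ℤ.- + j) (+ a ℤ.- + r ℤ.- + part mu j ℤ.+ + j)
      ≡⟨ ≡.cong (φhR R f x (+ i ℤ.- + j)) eq ⟩
    φhR R f x (+ i ℤ.- + j) (ℤ.- + (r ℕ.+ part mu j ℕ.∸ (a ℕ.+ j)))
      ≈⟨ negative (r ℕ.+ part mu j ℕ.∸ (a ℕ.+ j)) (ℕₚ.m<n⇒0<n∸m lt) ⟩
    0# ∎
    where
    lemma : ∀ a r p j → a ℤ.- r ℤ.- p ℤ.+ j ≡ (a ℤ.+ j) ℤ.- (r ℤ.+ p)
    lemma = ℤSolver.solve-∀
    eq : + a ℤ.- + r ℤ.- + part mu j ℤ.+ + j ≡ ℤ.- + (r ℕ.+ part mu j ℕ.∸ (a ℕ.+ j))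
    eq = ≡.trans (lemma (+ a) (+ r) (+ part mu j) (+ j))
        (≡.trans (ℤₚ.m-n≡m⊖n (a ℕ.+ j) (r ℕ.+ part mu j)) (ℤₚ.⊖-≤ (ℕₚ.<⇒≤ lt)))
    negative : ∀ d → 0 ℕ.< d → φhR R f x (+ i ℤ.- + j) (ℤ.- + d) ≈ 0#
    negative (suc d) _ = refl

  rowsFrom-vanish : ∀ f b r j l → Descending b l → b ℕ.+ j ℕ.< r ℕ.+ part mu j →
                    All (λ q → q j ≈ 0#) (map vec (rowsFrom r f l))
  rowsFrom-vanish f b r j []      _         lt = []
  rowsFrom-vanish f b r j (a ∷ l) (a≤b , d) lt =
    rowVec-vanish f r a r j lt′ ∷ rowsFrom-vanish f a (suc r) j l d (ℕₚ.m≤n⇒m≤1+n lt′)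
    where lt′ = ℕₚ.≤-<-trans (ℕₚ.+-monoˡ-≤ j a≤b) lt

  detRows : List Row → List ℕ → Carrier
  detRows rs = detL (map vec rs)

  -- The row just shortened to length c is subtracted from the next one if that has length c + 1,
  -- which in turn becomes the row to subtract. So the operations proceed downwards, and `pre`
  -- collects the finished rows.
  detRows-trim : ∀ (pre : List (ℕ → Carrier)) f i c l ys →
    detL (pre ++ vec (i , c , f) ∷ map vec (rowsFrom (suc i) f l)) ys ≈
    detL (pre ++ vec (i , c , f) ∷ map vec (rowsFrom (suc i) f (trim c l))) ys
  detRows-trim pre f i c []      ys = refl
  detRows-trim pre f i c (a ∷ l) ys with a ℕ.≟ suc c
  ... | no  _      = refl
  ... | yes ≡.refl = begin
    detL (pre ++ v ∷ vec (suc i , suc c , f) ∷ rest) ys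
      ≈⟨ detL-subtract pre rest (vec-pascal f i c) ys ⟩
    detL (pre ++ v ∷ vec (suc i , c , f) ∷ rest) ys
      ≡⟨ ≡.cong (λ q → detL q ys) (≡.sym (Lₚ.++-assoc pre (v ∷ []) _)) ⟩
    detL ((pre ++ v ∷ []) ++ vec (suc i , c , f) ∷ rest) ys
      ≈⟨ detRows-trim (pre ++ v ∷ []) f (suc i) c l ys ⟩
    detL ((pre ++ v ∷ []) ++ vec (suc i , c , f) ∷ map vec (rowsFrom (suc (suc i)) f (trim c l))) ys
      ≡⟨ ≡.cong (λ q → detL q ys) (Lₚ.++-assoc pre (v ∷ []) _) ⟩
    detL (pre ++ v ∷ vec (suc i , c , f) ∷ map vec (rowsFrom (suc (suc i)) f (trim c l))) ys ∎
    where
    v    = vec (i , c , f)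
    rest = map vec (rowsFrom (suc (suc i)) f l)

  detRows-step : ∀ (P : List Row) f i c l ys →
    detRows (P ++ rowsFrom i (suc f) (suc c ∷ l)) ys ≈
    detRows (P ++ (i , suc c , f) ∷ rowsFrom (suc i) (suc f) l) ys +
    x (suc f) * detRows (P ++ rowsFrom i (suc f) (c ∷ trim c l)) ys
  detRows-step P f i c l ys = begin
    detL (map vec (P ++ rowsFrom i (suc f) (suc c ∷ l))) ys
      ≡⟨ split (rowsFrom i (suc f) (suc c ∷ l)) ⟩
    detL (map vec P ++ vec (i , suc c , suc f) ∷ rest) ys
      ≈⟨ detL-linear (map vec P) rest (vec-newVariable f i c) ys ⟩
    detL (map vec P ++ vec (i , suc c , f) ∷ rest) ys +
      x (suc f) * detL (map vec P ++ vec (i , c , suc f) ∷ rest) ys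
      ≈⟨ +-cong (reflexive (≡.sym (split ((i , suc c , f) ∷ rowsFrom (suc i) (suc f) l))))
           (*-congˡ (trans (detRows-trim (map vec P) (suc f) i c l ys)
                           (reflexive (≡.sym (split (rowsFrom i (suc f) (c ∷ trim c l))))))) ⟩
    detRows (P ++ (i , suc c , f) ∷ rowsFrom (suc i) (suc f) l) ys +
      x (suc f) * detRows (P ++ rowsFrom i (suc f) (c ∷ trim c l)) ys ∎
    where
    rest = map vec (rowsFrom (suc i) (suc f) l)
    split : ∀ Q → detL (map vec (P ++ Q)) ys ≡ detL (map vec P ++ map vec Q) ys
    split Q = ≡.cong (λ q → detL q ys) (Lₚ.map-++ vec P Q)

  Antitone : Set
  Antitone = ∀ j i → 1 ℕ.≤ j → j ℕ.≤ i → part mu i ℕ.≤ part mu j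

  -- The error term has row i at z = b - i - 1. For j ≤ i one has μ_j ≥ μ_i ≥ b, so in the columns 1
  -- to i this row and all rows below it have entries of negative degree. Only the i - 1 rows of `P`
  -- can be nonzero there.
  detRows-emptyRow : Antitone → ∀ (P : List Row) f i b l n → i ≡ suc (length P) →
    Descending b l → b ℕ.≤ part mu i →
    detRows (P ++ rowsFrom i (suc f) (b ∷ l)) (upFrom 1 (i ℕ.+ n)) ≈
    detRows (P ++ (i , b , f) ∷ rowsFrom (suc i) (suc f) l) (upFrom 1 (i ℕ.+ n))
  detRows-emptyRow anti P f i b l n ≡.refl d b≤μ = begin
    detL (map vec (P ++ rowsFrom i (suc f) (b ∷ l))) ys
      ≡⟨ split (rowsFrom i (suc f) (b ∷ l)) ⟩
    detL (map vec P ++ vec (i , b , suc f) ∷ rest) ys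
      ≈⟨ detL-linear (map vec P) rest (rowVec-newVariable f i (+ b ℤ.- + i)) ys ⟩
    detL (map vec P ++ vec (i , b , f) ∷ rest) ys + x (suc f) * detL (map vec P ++ v ∷ rest) ys
      ≈⟨ +-congˡ (*-congˡ (reflexive (≡.cong (detL (map vec P ++ v ∷ rest)) (upFrom-+ 1 i n)))) ⟩
    detL (map vec P ++ vec (i , b , f) ∷ rest) ys +
      x (suc f) * detL (map vec P ++ v ∷ rest) (upFrom 1 i ++ upFrom (suc i) n)
      ≈⟨ +-congˡ (*-congˡ (detL-zeroBlock (map vec P) (v ∷ rest) (upFrom (suc i) n)
           (ℕₚ.≤-reflexive (≡.trans (≡.cong suc (Lₚ.length-map vec P)) (≡.sym (length-upFrom 1 i))))
           (All-upFrom 1 i zeros))) ⟩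
    detL (map vec P ++ vec (i , b , f) ∷ rest) ys + x (suc f) * 0#
      ≈⟨ trans (+-congˡ (zeroʳ _)) (+-identityʳ _) ⟩
    detL (map vec P ++ vec (i , b , f) ∷ rest) ys
      ≡⟨ ≡.sym (split ((i , b , f) ∷ rowsFrom (suc i) (suc f) l)) ⟩
    detRows (P ++ (i , b , f) ∷ rowsFrom (suc i) (suc f) l) ys ∎
    where
    ys   = upFrom 1 (i ℕ.+ n)
    rest = map vec (rowsFrom (suc i) (suc f) l)
    v    = rowVec (suc f) i (+ b ℤ.- + i ℤ.- + 1)
    split : ∀ Q → detL (map vec (P ++ Q)) ys ≡ detL (map vec P ++ map vec Q) ys
    split Q = ≡.cong (λ q → detL q ys) (Lₚ.map-++ vec P Q)
    lemma : ∀ b i → b ℤ.- i ℤ.- + 1 ≡ b ℤ.- (+ 1 ℤ.+ i)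
    lemma = ℤSolver.solve-∀
    zeros : ∀ j → 1 ℕ.≤ j → j ℕ.< suc i → All (λ q → q j ≈ 0#) (v ∷ rest)
    zeros j 1≤j (ℕ.s≤s j≤i) =
      trans (reflexive (≡.cong (λ z → rowVec (suc f) i z j) (lemma (+ b) (+ i))))
            (rowVec-vanish (suc f) i b (suc i) j lt) ∷
      rowsFrom-vanish (suc f) b (suc i) j l d lt
      where
      lt : b ℕ.+ j ℕ.< suc i ℕ.+ part mu j
      lt = ℕ.s≤s (≡.subst (b ℕ.+ j ℕ.≤_) (ℕₚ.+-comm (part mu j) i)
             (ℕₚ.+-mono-≤ (ℕₚ.≤-trans b≤μ (anti j i 1≤j j≤i)) j≤i))

  -- Column i is now the first one. Its diagonal entry is a power of φ applied to h_0, and the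
  -- entries below have negative degree.
  detRows-noVariables-equal : ∀ i l → Descending (part mu i) l →
    detRows (rowsFrom i 0 (part mu i ∷ l)) (upFrom i (suc (length l))) ≈
    detRows (rowsFrom (suc i) 0 l) (upFrom (suc i) (length l))
  detRows-noVariables-equal i l d =
    detL-unitColumn _ _ diagonal
      (rowsFrom-vanish 0 (part mu i) (suc i) i l d (ℕ.s≤s (ℕₚ.≤-reflexive (ℕₚ.+-comm (part mu i) i)))) _
    where
    lemma : ∀ p i → p ℤ.- i ℤ.- p ℤ.+ i ≡ + 0
    lemma = ℤSolver.solve-∀
    diagonal : vec (i , part mu i , 0) i ≈ 1#
    diagonal = trans (reflexive (≡.cong (φhR R 0 x (+ i ℤ.- + i)) (lemma (+ part mu i) (+ i)))) (φh-zero 0 (+ i ℤ.- + i))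

  -- In column j ≥ i the entry is the coefficient of t^(e+d) in (1 - t)^d, where d = j - i and e = a
  -- - μ_j > 0. This exceeds the degree, so the whole first row is zero.
  detRows-noVariables-longer : Antitone → ∀ i a l → 1 ℕ.≤ i → part mu i ℕ.< a →
    detRows (rowsFrom i 0 (a ∷ l)) (upFrom i (suc (length l))) ≈ 0#
  detRows-noVariables-longer anti i a l 1≤i μ<a =
    contract-zeroˡ (detL (map vec (rowsFrom (suc i) 0 l))) (All-upFrom i (suc (length l)) (λ j i≤j _ → vanish j i≤j))
    where
    lemma₁ : ∀ i d → i ℤ.- (i ℤ.+ d) ≡ ℤ.- d
    lemma₁ = ℤSolver.solve-∀
    lemma₂ : ∀ p e i d → (p ℤ.+ e) ℤ.- i ℤ.- p ℤ.+ (i ℤ.+ d) ≡ e ℤ.+ d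
    lemma₂ = ℤSolver.solve-∀
    vanish : ∀ j → i ℕ.≤ j → vec (i , a , 0) j ≈ 0#
    vanish j i≤j = begin
      φhR R 0 x (+ i ℤ.- + j) (+ a ℤ.- + i ℤ.- + p ℤ.+ + j)
        ≡⟨ ≡.cong₂ (λ j a → φhR R 0 x (+ i ℤ.- + j) (+ a ℤ.- + i ℤ.- + p ℤ.+ + j))
             (≡.sym (ℕₚ.m+[n∸m]≡n i≤j)) (≡.sym (ℕₚ.m+[n∸m]≡n (ℕₚ.<⇒≤ p<a))) ⟩
      φhR R 0 x (+ i ℤ.- + (i ℕ.+ d)) (+ (p ℕ.+ e) ℤ.- + i ℤ.- + p ℤ.+ + (i ℕ.+ d))
        ≡⟨ ≡.cong₂ (φhR R 0 x) (lemma₁ (+ i) (+ d)) (lemma₂ (+ p) (+ e) (+ i) (+ d)) ⟩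
      φhR R 0 x (ℤ.- + d) (+ (e ℕ.+ d))
        ≈⟨ φh-noVariables d (e ℕ.+ d) (ℕₚ.+-monoˡ-≤ d (ℕₚ.m<n⇒0<n∸m p<a)) ⟩
      0# ∎
      where
      p = part mu j
      d = j ℕ.∸ i
      e = a ℕ.∸ p
      p<a : p ℕ.< a
      p<a = ℕₚ.≤-<-trans (anti i j 1≤i i≤j) μ<a

-- Reverse plane partitions, column counts, and the removal of a strip

Cell : Set
Cell = ℕ × ℕ

T⇒≡true : ∀ {b} → T b → b ≡ true
T⇒≡true = Equivalence.to 𝔹ₚ.T-≡

≡true⇒T : ∀ {b} → b ≡ true → T b
≡true⇒T = Equivalence.from 𝔹ₚ.T-≡

T-injective : ∀ {b b′} → (T b → T b′) → (T b′ → T b) → b ≡ b′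
T-injective {true}  {true}  _ _ = ≡.refl
T-injective {true}  {false} f _ = ⊥-elim (f tt)
T-injective {false} {true}  _ g = ⊥-elim (g tt)
T-injective {false} {false} _ _ = ≡.refl

≡ᵇ-refl : ∀ n → (n ≡ᵇ n) ≡ true
≡ᵇ-refl n = T⇒≡true (ℕₚ.≡⇒≡ᵇ n n ≡.refl)

adjacent-right : ∀ i j → adjacent (i , j) (i , suc j) ≡ true
adjacent-right i j rewrite ≡ᵇ-refl i | ≡ᵇ-refl j = ≡.refl

adjacent-below : ∀ i j → adjacent (i , j) (suc i , j) ≡ true
adjacent-below i j rewrite ≡ᵇ-refl i | ≡ᵇ-refl j = 𝔹ₚ.∨-zeroʳ _

adjacent⇒ : ∀ i j i′ j′ → adjacent (i , j) (i′ , j′) ≡ true →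
            (i′ ≡ i × j′ ≡ suc j) ⊎ (i′ ≡ suc i × j′ ≡ j)
adjacent⇒ i j i′ j′ adj with Equivalence.to 𝔹ₚ.T-∨ (≡true⇒T adj)
... | inj₁ t = let p , q = Equivalence.to 𝔹ₚ.T-∧ t in inj₁ (ℕₚ.≡ᵇ⇒≡ i′ i p , ℕₚ.≡ᵇ⇒≡ j′ (suc j) q)
... | inj₂ t = let p , q = Equivalence.to 𝔹ₚ.T-∧ t in inj₂ (ℕₚ.≡ᵇ⇒≡ i′ (suc i) p , ℕₚ.≡ᵇ⇒≡ j′ j q)

IsRPP : Filling → Set
IsRPP t = ∀ {c a c′ a′} → (c , a) ∈ t → (c′ , a′) ∈ t → adjacent c c′ ≡ true → a ℕ.≤ a′

isRPP⇒ : ∀ t → T (isRPP t) → IsRPP t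
isRPP⇒ t p {c} {a} {c′} {a′} e e′ adj =
  ℕₚ.≤ᵇ⇒≤ a a′ (≡.subst (λ b → T (if b then a ≤ᵇ a′ else true)) adj
    (All.lookup (Allₚ.all⁺ _ t (All.lookup (Allₚ.all⁺ _ t p) e)) e′))

isRPP⇐ : ∀ t → IsRPP t → T (isRPP t)
isRPP⇐ t r = Allₚ.all⁻ _ {t} (All.tabulate λ { {c , a} e →
  Allₚ.all⁻ _ {t} (All.tabulate λ { {c′ , a′} e′ → ok c a c′ a′ e e′ }) })
  where
  ok : ∀ c a c′ a′ → (c , a) ∈ t → (c′ , a′) ∈ t → T (if adjacent c c′ then a ≤ᵇ a′ else true)
  ok c a c′ a′ e e′ with adjacent c c′ in eq
  ... | true  = ℕₚ.≤⇒≤ᵇ (r e e′ eq)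
  ... | false = tt

isRPP-↭ : ∀ {t t′} → t ↭ t′ → isRPP t ≡ isRPP t′
isRPP-↭ {t} {t′} p = T-injective
  (λ q → isRPP⇐ t′ (λ e e′ → isRPP⇒ t q (∈-resp-↭ (↭-sym p) e) (∈-resp-↭ (↭-sym p) e′)))
  (λ q → isRPP⇐ t (λ e e′ → isRPP⇒ t′ q (∈-resp-↭ p e) (∈-resp-↭ p e′)))

any-↭ : ∀ {A : Set} (p : A → Bool) {as bs} → as ↭ bs → any p as ≡ any p bs
any-↭ p {as} {bs} s = T-injective
  (λ q → Anyₚ.any⁺ p (Any-resp-↭ s (Anyₚ.any⁻ p as q)))
  (λ q → Anyₚ.any⁺ p (Any-resp-↭ (↭-sym s) (Anyₚ.any⁻ p bs q)))

any-++ : ∀ {A : Set} (p : A → Bool) as bs → any p (as ++ bs) ≡ any p as ∨ any p bs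
any-++ p []       bs = ≡.refl
any-++ p (a ∷ as) bs = ≡.trans (≡.cong (p a ∨_) (any-++ p as bs)) (≡.sym (𝔹ₚ.∨-assoc (p a) _ _))

any-false : ∀ {A : Set} {p : A → Bool} {as} → All (λ a → p a ≡ false) as → any p as ≡ false
any-false []       = ≡.refl
any-false (q ∷ qs) rewrite q = any-false qs

hits : ℕ → ℕ → Cell × ℕ → Bool
hits j v ((_ , j′) , w) = (j′ ≡ᵇ j) ∧ (w ≡ᵇ v)

hits-false : ∀ {j v j′ w} i → (j′ ≡ j → w ≢ v) → hits j v ((i , j′) , w) ≡ false
hits-false {j} {v} {j′} {w} i ne with j′ ≡ᵇ j in eq₁ | w ≡ᵇ v in eq₂
... | false | _     = ≡.refl
... | true  | false = ≡.refl
... | true  | true  = ⊥-elim (ne (ℕₚ.≡ᵇ⇒≡ j′ j (≡true⇒T eq₁)) (ℕₚ.≡ᵇ⇒≡ w v (≡true⇒T eq₂)))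

count-cong : ∀ {A : Set} {p q : A → Bool} as → (∀ a → p a ≡ q a) → count p as ≡ count q as
count-cong []       p≡q = ≡.refl
count-cong (a ∷ as) p≡q rewrite p≡q a | count-cong as p≡q = ≡.refl

bit : Bool → ℕ
bit b = if b then 1 else 0

count-∷ʳ : ∀ {A : Set} (p : A → Bool) as a → count p (as ++ a ∷ []) ≡ count p as ℕ.+ bit (p a)
count-∷ʳ p []       a = ≡.refl
count-∷ʳ p (b ∷ as) a with p b
... | true  = ≡.cong suc (count-∷ʳ p as a)
... | false = count-∷ʳ p as a

count-range-suc : ∀ p n → count p (range 0 (suc n)) ≡ count p (range 0 n) ℕ.+ bit (p (suc n))
count-range-suc p n = ≡.trans (≡.cong (count p) (range-suc n)) (count-∷ʳ p (range 0 n) (suc n))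

count-range-cong : ∀ {p q : ℕ → Bool} n → (∀ a → a ℕ.≤ n → p a ≡ q a) →
                   count p (range 0 n) ≡ count q (range 0 n)
count-range-cong         zero    p≡q = ≡.refl
count-range-cong {p} {q} (suc n) p≡q = ≡.trans (count-range-suc p n) (≡.trans
  (≡.cong₂ (λ k b → k ℕ.+ bit b) (count-range-cong n (λ a a≤n → p≡q a (ℕₚ.m≤n⇒m≤1+n a≤n)))
                                  (p≡q (suc n) ℕₚ.≤-refl))
  (≡.sym (count-range-suc q n)))

count-range-extra : ∀ {p q : ℕ → Bool} {k} n → k ℕ.< n → p (suc k) ≡ true → q (suc k) ≡ false →
                    (∀ a → a ≢ suc k → p a ≡ q a) → count p (range 0 n) ≡ suc (count q (range 0 n))
count-range-extra {p} {q} {k} (suc n) k<1+n pk qk p≡q with k ℕ.≟ n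
... | yes ≡.refl = begin
  count p (range 0 (suc n))                      ≡⟨ count-range-suc p n ⟩
  count p (range 0 n) ℕ.+ bit (p (suc n))        ≡⟨ ≡.cong₂ (λ u b → u ℕ.+ bit b)
                                                      (count-range-cong n (λ a a≤n → p≡q a (ℕₚ.<⇒≢ (ℕ.s≤s a≤n)))) pk ⟩
  count q (range 0 n) ℕ.+ 1                      ≡⟨ ℕₚ.+-suc _ 0 ⟩
  suc (count q (range 0 n) ℕ.+ 0)                ≡⟨ ≡.cong (λ b → suc (count q (range 0 n) ℕ.+ bit b)) (≡.sym qk) ⟩
  suc (count q (range 0 n) ℕ.+ bit (q (suc n)))  ≡⟨ ≡.cong suc (≡.sym (count-range-suc q n)) ⟩
  suc (count q (range 0 (suc n)))                ∎
  where open ≡.≡-Reasoning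
... | no k≢n = begin
  count p (range 0 (suc n))                      ≡⟨ count-range-suc p n ⟩
  count p (range 0 n) ℕ.+ bit (p (suc n))        ≡⟨ ≡.cong₂ (λ u b → u ℕ.+ bit b)
                                                      (count-range-extra n (ℕₚ.≤∧≢⇒< (ℕ.s≤s⁻¹ k<1+n) k≢n) pk qk p≡q)
                                                      (p≡q (suc n) (λ { ≡.refl → k≢n ≡.refl })) ⟩
  suc (count q (range 0 n) ℕ.+ bit (q (suc n)))  ≡⟨ ≡.cong suc (≡.sym (count-range-suc q n)) ⟩
  suc (count q (range 0 (suc n)))                ∎
  where open ≡.≡-Reasoning

colCount≡ : ∀ la t v → colCount la t v ≡ count (λ j → any (hits j v) t) (range 0 (part la 1))
colCount≡ la t v = count-cong (range 0 (part la 1)) (λ j → ≡.cong or (Lₚ.map-cong (λ _ → ≡.refl) t))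

colCount-↭ : ∀ la {t t′} v → t ↭ t′ → colCount la t v ≡ colCount la t′ v
colCount-↭ la {t} {t′} v s = ≡.trans (colCount≡ la t v) (≡.trans
  (count-cong (range 0 (part la 1)) (λ j → any-↭ (hits j v) s)) (≡.sym (colCount≡ la t′ v)))

-- The entries g in column b + 1, rows i and below, of the boxes outside the trimmed shape.
Strip : (i b g : ℕ) → Cell × ℕ → Set
Strip i b g e = ∃[ r ] (i ℕ.≤ r × e ≡ ((r , suc b) , g))

-- The bound on the entries of the trimmed shape, when rows from i on have length at most b.
Trimmed : (i b f : ℕ) → Cell → ℕ → Set
Trimmed i b f (r , j) a = a ℕ.≤ suc f × ((r ℕ.< i × a ℕ.≤ f) ⊎ j ℕ.≤ b)

module _ {i b f : ℕ} {s t : Filling} (ps : All (Strip i b (suc f)) s)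
         (pt : All (λ { (c , a) → Trimmed i b f c a }) t) where

  private
    in-t : ∀ {c a} → (c , a) ∈ t → Trimmed i b f c a
    in-t e = All.lookup pt e

  -- The strip entries equal f + 1, the maximum, so they agree with each other and no entry of `t`
  -- before them is too large. A box to the right of or below the strip would lie in a row from i on
  -- and in a column beyond b, where `t` has no box.
  isRPP-strip : isRPP (s ++ t) ≡ isRPP t
  isRPP-strip = T-injective
    (λ q → isRPP⇐ t (λ e e′ → isRPP⇒ (s ++ t) q (∈-++⁺ʳ s e) (∈-++⁺ʳ s e′)))
    (λ q → isRPP⇐ (s ++ t) (λ e e′ → join (isRPP⇒ t q) (∈-++⁻ s e) (∈-++⁻ s e′)))
    where
    join : IsRPP t → ∀ {c a c′ a′} → (c , a) ∈ s ⊎ (c , a) ∈ t → (c′ , a′) ∈ s ⊎ (c′ , a′) ∈ t →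
           adjacent c c′ ≡ true → a ℕ.≤ a′
    join q (inj₂ e) (inj₂ e′) adj = q e e′ adj
    join q (inj₁ e) (inj₁ e′) adj with All.lookup ps e | All.lookup ps e′
    ... | _ , _ , ≡.refl | _ , _ , ≡.refl = ℕₚ.≤-refl
    join q (inj₂ e) (inj₁ e′) adj with All.lookup ps e′
    ... | _ , _ , ≡.refl = proj₁ (in-t e)
    join q {c′ = r′ , j′} (inj₁ e) (inj₂ e′) adj with All.lookup ps e
    ... | r , i≤r , ≡.refl with adjacent⇒ r (suc b) r′ j′ adj | proj₂ (in-t e′)
    ... | inj₁ (≡.refl , ≡.refl) | inj₁ (r<i , _) = ⊥-elim (ℕₚ.<⇒≱ r<i i≤r)
    ... | inj₁ (≡.refl , ≡.refl) | inj₂ le        = ⊥-elim (ℕₚ.<⇒≱ (ℕₚ.m<n⇒m<1+n (ℕₚ.n<1+n b)) le)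
    ... | inj₂ (≡.refl , ≡.refl) | inj₁ (r<i , _) = ⊥-elim (ℕₚ.<⇒≱ r<i (ℕₚ.m≤n⇒m≤1+n i≤r))
    ... | inj₂ (≡.refl , ≡.refl) | inj₂ le        = ⊥-elim (ℕₚ.<⇒≱ (ℕₚ.n<1+n b) le)

  private
    any-strip-other : ∀ {j v} → (suc b ≡ j → suc f ≢ v) → any (hits j v) (s ++ t) ≡ any (hits j v) t
    any-strip-other {j} {v} ne = ≡.trans (any-++ (hits j v) s t) (≡.cong (_∨ any (hits j v) t)
      (any-false (All.map (λ { (r , _ , ≡.refl) → hits-false r ne }) ps)))

    any-t : any (hits (suc b) (suc f)) t ≡ false
    any-t = any-false (All.map (λ { {(r , j) , a} p → misses r j a (proj₂ p) }) pt)
      where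
      misses : ∀ r j a → (r ℕ.< i × a ℕ.≤ f) ⊎ j ℕ.≤ b → hits (suc b) (suc f) ((r , j) , a) ≡ false
      misses r j a (inj₁ (_ , a≤f)) = hits-false {suc b} {suc f} {j} {a} r (λ _ → ℕₚ.<⇒≢ (ℕ.s≤s a≤f))
      misses r j a (inj₂ j≤b)       = hits-false {suc b} {suc f} {j} {a} r (λ j≡ → ⊥-elim (ℕₚ.<⇒≢ (ℕ.s≤s j≤b) j≡))

  colCount-strip-other : ∀ la v → v ≢ suc f → colCount la (s ++ t) v ≡ colCount la t v
  colCount-strip-other la v v≢ = ≡.trans (colCount≡ la (s ++ t) v) (≡.trans
    (count-cong (range 0 (part la 1)) (λ j → any-strip-other (λ _ f≡v → v≢ (≡.sym f≡v))))
    (≡.sym (colCount≡ la t v)))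

  -- The boxes of `t` in column b + 1 lie above row i and have entries at most f. So f + 1 is
  -- present in this column with the strip and absent without it, however long the strip is; the
  -- other columns do not change.
  colCount-strip : ∀ la → b ℕ.< part la 1 → s ≢ [] → colCount la (s ++ t) (suc f) ≡ suc (colCount la t (suc f))
  colCount-strip la b< s≢[] = ≡.trans (colCount≡ la (s ++ t) (suc f)) (≡.trans
    (count-range-extra (part la 1) b<
      (≡.trans (any-++ (hits (suc b) (suc f)) s t) (≡.cong (_∨ any (hits (suc b) (suc f)) t) (any-s ps s≢[])))
      any-t (λ j j≢ → any-strip-other (λ b≡j → ⊥-elim (j≢ (≡.sym b≡j)))))
    (≡.cong suc (≡.sym (colCount≡ la t (suc f)))))
    where
    any-s : ∀ {s} → All (Strip i b (suc f)) s → s ≢ [] → any (hits (suc b) (suc f)) s ≡ true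
    any-s []                      ne = ⊥-elim (ne ≡.refl)
    any-s ((r , _ , ≡.refl) ∷ _) ne rewrite ≡ᵇ-refl b | ≡ᵇ-refl f = ≡.refl

-- Sums over fillings with a separate bound for each box

module Fillings {c ℓ : Level} (R : CommutativeRing c ℓ) where
  open CommutativeRing R
  open SetoidReasoning setoid
  open Sums R

  Symmetric : (Filling → Carrier) → Set ℓ
  Symmetric g = ∀ {t t′} → t ↭ t′ → g t ≈ g t′

  -- Each box carries its own bound, so the bound can be lowered in a single row.
  fillSum : List (Cell × ℕ) → (Filling → Carrier) → Carrier
  fillSum []             g = g []
  fillSum ((d , β) ∷ cs) g = ∑ β (λ a → fillSum cs (λ t → g ((d , a) ∷ t)))

  fillSum-cong : ∀ cs {g g′ : Filling → Carrier} → (∀ t → g t ≈ g′ t) → fillSum cs g ≈ fillSum cs g′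
  fillSum-cong []             g≈g′ = g≈g′ []
  fillSum-cong ((d , β) ∷ cs) g≈g′ = ∑-cong β (λ a _ → fillSum-cong cs (λ t → g≈g′ ((d , a) ∷ t)))

  fillSum-congOn : ∀ {p} (P : Cell → ℕ → Set p) cs {g g′ : Filling → Carrier} →
    All (λ { (d , β) → ∀ a → a ℕ.≤ β → P d a }) cs →
    (∀ t → All (λ { (d , a) → P d a }) t → g t ≈ g′ t) → fillSum cs g ≈ fillSum cs g′
  fillSum-congOn P []             []       g≈g′ = g≈g′ [] []
  fillSum-congOn P ((d , β) ∷ cs) (p ∷ ps) g≈g′ =
    ∑-cong β (λ a a≤β → fillSum-congOn P cs ps (λ t pt → g≈g′ ((d , a) ∷ t) (p a a≤β ∷ pt)))

  fillSum-zero : ∀ cs {g : Filling → Carrier} → (∀ t → g t ≈ 0#) → fillSum cs g ≈ 0#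
  fillSum-zero []             g≈0 = g≈0 []
  fillSum-zero ((d , β) ∷ cs) g≈0 = ∑-zero β (λ a _ → fillSum-zero cs (λ t → g≈0 ((d , a) ∷ t)))

  fillSum-scale : ∀ cs y (g : Filling → Carrier) → fillSum cs (λ t → y * g t) ≈ y * fillSum cs g
  fillSum-scale []             y g = refl
  fillSum-scale ((d , β) ∷ cs) y g =
    trans (∑-cong β (λ a _ → fillSum-scale cs y (λ t → g ((d , a) ∷ t)))) (∑-scale β y _)

  -- Finite sums may be interchanged. This allows the box whose entry is to be distinguished to be
  -- summed over first.
  fillSum-↭ : ∀ {cs cs′} {g : Filling → Carrier} → Symmetric g → cs ↭ cs′ → fillSum cs g ≈ fillSum cs′ g
  fillSum-↭ σ Perm.refl               = refl
  fillSum-↭ σ (Perm.prep (d , β) s)   = ∑-cong β (λ a _ → fillSum-↭ (λ q → σ (Perm.prep (d , a) q)) s)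
  fillSum-↭ {(d , β) ∷ (d′ , β′) ∷ cs} {_ ∷ _ ∷ cs′} σ (Perm.swap _ _ s) = trans
    (∑-swap β β′ _)
    (∑-cong β′ (λ a′ _ → ∑-cong β (λ a _ → trans
      (fillSum-↭ (λ q → σ (Perm.prep (d , a) (Perm.prep (d′ , a′) q))) s)
      (fillSum-cong cs′ (λ t → σ (Perm.swap (d , a) (d′ , a′) (Perm.refl {xs = t})))))))
  fillSum-↭ σ (Perm.trans s s′)       = trans (fillSum-↭ σ s) (fillSum-↭ σ s′)

  fillSum-words : ∀ m cs (g : Filling → Carrier) →
    wordSum m (length cs) (λ w → g (zip cs w)) ≈ fillSum (map (_, m) cs) g
  fillSum-words m []       g = refl
  fillSum-words m (d ∷ cs) g = ∑-cong m (λ a _ → fillSum-words m cs (λ t → g ((d , a) ∷ t)))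

  prodR-∷ʳ : ∀ as a → prodR R (as ++ a ∷ []) ≈ prodR R as * a
  prodR-∷ʳ []       a = *-comm a 1#
  prodR-∷ʳ (b ∷ as) a = trans (*-congˡ (prodR-∷ʳ as a)) (sym (*-assoc b _ a))

  prodR-range-suc : ∀ g n → prodR R (map g (range 0 (suc n))) ≈ prodR R (map g (range 0 n)) * g (suc n)
  prodR-range-suc g n = trans
    (reflexive (≡.cong (prodR R) (≡.trans (≡.cong (map g) (range-suc n)) (Lₚ.map-++ g (range 0 n) (suc n ∷ [])))))
    (prodR-∷ʳ (map g (range 0 n)) (g (suc n)))

  prodR-range-cong : ∀ {g g′ : ℕ → Carrier} n → (∀ a → a ℕ.≤ n → g a ≈ g′ a) →
                     prodR R (map g (range 0 n)) ≈ prodR R (map g′ (range 0 n))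
  prodR-range-cong          zero    g≈g′ = refl
  prodR-range-cong {g} {g′} (suc n) g≈g′ = trans (prodR-range-suc g n) (trans
    (*-cong (prodR-range-cong n (λ a a≤n → g≈g′ a (ℕₚ.m≤n⇒m≤1+n a≤n))) (g≈g′ (suc n) ℕₚ.≤-refl))
    (sym (prodR-range-suc g′ n)))

  prodR-range-extra : ∀ {g g′ : ℕ → Carrier} {y k} n → k ℕ.< n → g (suc k) ≈ y * g′ (suc k) →
                      (∀ a → a ≢ suc k → g a ≈ g′ a) →
                      prodR R (map g (range 0 n)) ≈ y * prodR R (map g′ (range 0 n))
  prodR-range-extra {g} {g′} {y} {k} (suc n) k<1+n gk g≈g′ with k ℕ.≟ n
  ... | yes ≡.refl = begin
    prodR R (map g (range 0 (suc n)))                   ≈⟨ prodR-range-suc g n ⟩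
    prodR R (map g (range 0 n)) * g (suc n)             ≈⟨ *-cong (prodR-range-cong n (λ a a≤n → g≈g′ a (ℕₚ.<⇒≢ (ℕ.s≤s a≤n)))) gk ⟩
    prodR R (map g′ (range 0 n)) * (y * g′ (suc n))     ≈⟨ sym (*-assoc _ y _) ⟩
    prodR R (map g′ (range 0 n)) * y * g′ (suc n)       ≈⟨ *-congʳ (*-comm _ y) ⟩
    y * prodR R (map g′ (range 0 n)) * g′ (suc n)       ≈⟨ *-assoc y _ _ ⟩
    y * (prodR R (map g′ (range 0 n)) * g′ (suc n))     ≈⟨ *-congˡ (sym (prodR-range-suc g′ n)) ⟩
    y * prodR R (map g′ (range 0 (suc n)))              ∎
  ... | no k≢n = begin
    prodR R (map g (range 0 (suc n)))                   ≈⟨ prodR-range-suc g n ⟩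
    prodR R (map g (range 0 n)) * g (suc n)             ≈⟨ *-cong (prodR-range-extra n (ℕₚ.≤∧≢⇒< (ℕ.s≤s⁻¹ k<1+n) k≢n) gk g≈g′)
                                                            (g≈g′ (suc n) (λ { ≡.refl → k≢n ≡.refl })) ⟩
    y * prodR R (map g′ (range 0 n)) * g′ (suc n)       ≈⟨ *-assoc y _ _ ⟩
    y * (prodR R (map g′ (range 0 n)) * g′ (suc n))     ≈⟨ *-congˡ (sym (prodR-range-suc g′ n)) ⟩
    y * prodR R (map g′ (range 0 (suc n)))              ∎

-- The boxes run from right to left: the case distinction is on the last box of a row, and a bound
-- on its entry spreads to the left.
rowCells : ℕ → ℕ → ℕ → ℕ → List (Cell × ℕ)
rowCells f i lo zero    = []
rowCells f i lo (suc d) = ((i , lo ℕ.+ suc d) , f) ∷ rowCells f i lo d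

All-rowCells : ∀ {p} {P : Cell × ℕ → Set p} f i lo d → (∀ j → j ℕ.≤ lo ℕ.+ d → P ((i , j) , f)) →
               All P (rowCells f i lo d)
All-rowCells f i lo zero    p = []
All-rowCells f i lo (suc d) p =
  p (lo ℕ.+ suc d) ℕₚ.≤-refl ∷
  All-rowCells f i lo d (λ j j≤ → p j (ℕₚ.≤-trans j≤ (ℕₚ.+-monoʳ-≤ lo (ℕₚ.n≤1+n d))))

m+[n∸m]≤o : ∀ {m n o} → m ℕ.≤ o → n ℕ.≤ o → m ℕ.+ (n ℕ.∸ m) ℕ.≤ o
m+[n∸m]≤o {m} {n} {o} m≤o n≤o with ℕₚ.≤-total m n
... | inj₁ m≤n = ≡.subst (ℕ._≤ o) (≡.sym (ℕₚ.m+[n∸m]≡n m≤n)) n≤o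
... | inj₂ n≤m = ≡.subst (ℕ._≤ o) (≡.sym (≡.trans (≡.cong (m ℕ.+_) (ℕₚ.m≤n⇒m∸n≡0 n≤m)) (ℕₚ.+-identityʳ m))) m≤o

trim-descending : ∀ c l → Descending (suc c) l → Descending c (trim c l)
trim-descending c []      _       = _
trim-descending c (a ∷ l) (a≤ , d) with a ℕ.≟ suc c
... | yes ≡.refl = ℕₚ.≤-refl , trim-descending c l d
... | no  a≢     = ℕ.s≤s⁻¹ (ℕₚ.≤∧≢⇒< a≤ a≢) , d

-- The entries of column c + 1 deleted by trim, all equal to f, put in front of s.
strip : ℕ → ℕ → ℕ → List ℕ → Filling → Filling
strip f c q []      s = s
strip f c q (a ∷ l) s with a ℕ.≟ suc c
... | yes _ = strip f c (suc q) l (((q , suc c) , f) ∷ s)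
... | no  _ = s

strip-Strip : ∀ {f c i} q l s → i ℕ.≤ q → All (Strip i c f) s → All (Strip i c f) (strip f c q l s)
strip-Strip         q []      s i≤q ps = ps
strip-Strip {c = c} q (a ∷ l) s i≤q ps with a ℕ.≟ suc c
... | yes _ = strip-Strip (suc q) l _ (ℕₚ.m≤n⇒m≤1+n i≤q) ((q , i≤q , ≡.refl) ∷ ps)
... | no  _ = ps

strip-nonempty : ∀ {f c} q l s → s ≢ [] → strip f c q l s ≢ []
strip-nonempty         q []      s ne = ne
strip-nonempty {c = c} q (a ∷ l) s ne with a ℕ.≟ suc c
... | yes _ = strip-nonempty (suc q) l _ (λ ())
... | no  _ = ne

-- The recursion for the generating function of reverse plane partitions

module Weighted {c ℓ : Level} (R : CommutativeRing c ℓ) (x : ℕ → CommutativeRing.Carrier R)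
  (m : ℕ) (la mu : List ℕ) where
  open CommutativeRing R
  open SetoidReasoning setoid
  open Sums R
  open Fillings R

  weight : Filling → Carrier
  weight t = prodR R (map (λ v → powR R (x v) (colCount la t v)) (range 0 m))

  term : Filling → Carrier
  term t = when (isRPP t) (weight t)

  term-↭ : Symmetric term
  term-↭ {t} {t′} s = trans (reflexive (≡.cong (λ b → when b (weight t)) (isRPP-↭ s)))
    (when-cong (isRPP t′) (prodR-range-cong m (λ v _ → reflexive (≡.cong (powR R (x v)) (colCount-↭ la v s)))))

  term-violation : ∀ {d a d′ a′} t → (d , a) ∈ t → (d′ , a′) ∈ t → adjacent d d′ ≡ true → a′ ℕ.< a →
                   term t ≈ 0#
  term-violation t e e′ adj a′<a with isRPP t in eq
  ... | false = refl
  ... | true  = ⊥-elim (ℕₚ.<⇒≱ a′<a (isRPP⇒ t (≡true⇒T eq) e e′ adj))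

  term-strip : ∀ {i b f} s t → f ℕ.< m → b ℕ.< part la 1 → s ≢ [] → All (Strip i b (suc f)) s →
               All (λ { (d , a) → Trimmed i b f d a }) t → term (s ++ t) ≈ x (suc f) * term t
  term-strip {i} {b} {f} s t f<m b< ne ps pt = begin
    when (isRPP (s ++ t)) (weight (s ++ t))
      ≡⟨ ≡.cong (λ p → when p (weight (s ++ t))) (isRPP-strip ps pt) ⟩
    when (isRPP t) (weight (s ++ t))
      ≈⟨ when-cong (isRPP t) (prodR-range-extra m f<m
           (reflexive (≡.cong (powR R (x (suc f))) (colCount-strip ps pt la b< ne)))
           (λ v v≢ → reflexive (≡.cong (powR R (x v)) (colCount-strip-other ps pt la v v≢)))) ⟩
    when (isRPP t) (x (suc f) * weight t)
      ≈⟨ when-* (isRPP t) ⟩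
    x (suc f) * when (isRPP t) (weight t) ∎
    where
    when-* : ∀ p → when p (x (suc f) * weight t) ≈ x (suc f) * when p (weight t)
    when-* true  = refl
    when-* false = sym (zeroʳ _)

  cellsOf : Row → List (Cell × ℕ)
  cellsOf (i , a , f) = rowCells f i (part mu i) (a ℕ.∸ part mu i)

  cellsOfAll : List Row → List (Cell × ℕ)
  cellsOfAll = concatMap cellsOf

  fillRows : List Row → Carrier
  fillRows rs = fillSum (cellsOfAll rs) term

  μ+suc : ∀ i {c} → part mu i ℕ.≤ c → part mu i ℕ.+ suc (c ℕ.∸ part mu i) ≡ suc c
  μ+suc i {c} le = ≡.trans (ℕₚ.+-suc (part mu i) _) (≡.cong suc (ℕₚ.m+[n∸m]≡n le))

  cellsOf-suc : ∀ i {c} f → part mu i ℕ.≤ c → cellsOf (i , suc c , f) ≡ ((i , suc c) , f) ∷ cellsOf (i , c , f)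
  cellsOf-suc i {c} f le = ≡.trans (≡.cong (rowCells f i (part mu i)) (ℕₚ.+-∸-assoc 1 le))
    (≡.cong (λ j → ((i , j) , f) ∷ cellsOf (i , c , f)) (μ+suc i le))

  cellsOf-empty : ∀ i {a} f → a ℕ.≤ part mu i → cellsOf (i , a , f) ≡ []
  cellsOf-empty i f le = ≡.cong (rowCells f i (part mu i)) (ℕₚ.m≤n⇒m∸n≡0 le)

  term-after : Filling → Filling → Carrier
  term-after s t = term (s ++ t)

  after-↭ : ∀ s → Symmetric (term-after s)
  after-↭ s p = term-↭ (++⁺ˡ s p)

  after-∷ : ∀ cs s e → fillSum cs (λ t → term-after s (e ∷ t)) ≈ fillSum cs (term-after (e ∷ s))
  after-∷ cs s e = fillSum-cong cs (λ t → term-↭ (shift e s t))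

  -- The entry `a` belongs to the box just right of the remaining ones. The value f + 1 in the next
  -- box would violate the row condition; any smaller value takes over the role of `a`.
  fillSum-lowerRow : ∀ d lo f i a s cs → ((i , lo ℕ.+ suc d) , a) ∈ s → a ℕ.≤ f →
    fillSum (rowCells (suc f) i lo d ++ cs) (term-after s) ≈ fillSum (rowCells f i lo d ++ cs) (term-after s)
  fillSum-lowerRow zero    lo f i a s cs e a≤f = refl
  fillSum-lowerRow (suc d) lo f i a s cs e a≤f = begin
    ∑ f (λ a′ → fillSum (rowCells (suc f) i lo d ++ cs) (λ t → term-after s (((i , lo ℕ.+ suc d) , a′) ∷ t)))
      + fillSum (rowCells (suc f) i lo d ++ cs) (λ t → term-after s (((i , lo ℕ.+ suc d) , suc f) ∷ t))
      ≈⟨ +-cong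
           (∑-cong f (λ a′ a′≤f → trans
             (after-∷ (rowCells (suc f) i lo d ++ cs) s ((i , lo ℕ.+ suc d) , a′)) (trans
             (fillSum-lowerRow d lo f i a′ (((i , lo ℕ.+ suc d) , a′) ∷ s) cs (here ≡.refl) a′≤f)
             (sym (after-∷ (rowCells f i lo d ++ cs) s ((i , lo ℕ.+ suc d) , a′))))))
           (fillSum-zero (rowCells (suc f) i lo d ++ cs) (λ t →
             term-violation (s ++ ((i , lo ℕ.+ suc d) , suc f) ∷ t) (∈-++⁺ʳ s (here ≡.refl)) (∈-++⁺ˡ e)
               (≡.subst (λ j → adjacent (i , lo ℕ.+ suc d) (i , j) ≡ true) (≡.sym (ℕₚ.+-suc lo (suc d)))
                 (adjacent-right i (lo ℕ.+ suc d)))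
               (ℕ.s≤s a≤f))) ⟩
    ∑ f (λ a′ → fillSum (rowCells f i lo d ++ cs) (λ t → term-after s (((i , lo ℕ.+ suc d) , a′) ∷ t))) + 0#
      ≈⟨ +-identityʳ _ ⟩
    ∑ f (λ a′ → fillSum (rowCells f i lo d ++ cs) (λ t → term-after s (((i , lo ℕ.+ suc d) , a′) ∷ t))) ∎

  -- Entries below a maximal entry are maximal, so the whole strip is forced.
  fillSum-strip : ∀ f b q l s cs → (∀ r → q ℕ.< r → part mu r ℕ.≤ b) → ((q , suc b) , suc f) ∈ s →
    fillSum (cellsOfAll (rowsFrom (suc q) (suc f) l) ++ cs) (term-after s) ≈
    fillSum (cellsOfAll (rowsFrom (suc q) (suc f) (trim b l)) ++ cs) (term-after (strip (suc f) b (suc q) l s))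
  fillSum-strip f b q []      s cs μ≤ e = refl
  fillSum-strip f b q (a ∷ l) s cs μ≤ e with a ℕ.≟ suc b
  ... | no  _      = refl
  ... | yes ≡.refl = begin
    fillSum ((cellsOf (q′ , suc b , suc f) ++ L) ++ cs) (term-after s)
      ≡⟨ ≡.cong (λ cells → fillSum ((cells ++ L) ++ cs) (term-after s)) (cellsOf-suc q′ (suc f) (μ≤ q′ ℕₚ.≤-refl)) ⟩
    ∑ f (λ a → fillSum ((K ++ L) ++ cs) (λ t → term-after s (((q′ , suc b) , a) ∷ t)))
      + fillSum ((K ++ L) ++ cs) (λ t → term-after s (((q′ , suc b) , suc f) ∷ t))
      ≈⟨ +-cong (∑-zero f (λ a a≤f → fillSum-zero ((K ++ L) ++ cs) (λ t →
                  term-violation (s ++ ((q′ , suc b) , a) ∷ t) (∈-++⁺ˡ e) (∈-++⁺ʳ s (here ≡.refl))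
                    (adjacent-below q (suc b)) (ℕ.s≤s a≤f))))
                (after-∷ ((K ++ L) ++ cs) s _) ⟩
    0# + fillSum ((K ++ L) ++ cs) (term-after s′)
      ≈⟨ +-identityˡ _ ⟩
    fillSum ((K ++ L) ++ cs) (term-after s′)
      -- The rest of this row is set aside in `cs`, so that the induction can go on with the rows
      -- below.
      ≈⟨ fillSum-↭ (after-↭ s′) (rotate K L) ⟩
    fillSum (L ++ K ++ cs) (term-after s′)
      ≈⟨ fillSum-strip f b q′ l s′ (K ++ cs) (λ r q′<r → μ≤ r (ℕₚ.<⇒≤ q′<r)) (here ≡.refl) ⟩
    fillSum (L′ ++ K ++ cs) (term-after (strip (suc f) b (suc q′) l s′))
      ≈⟨ fillSum-↭ (after-↭ (strip (suc f) b (suc q′) l s′)) (↭-sym (rotate K L′)) ⟩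
    fillSum ((K ++ L′) ++ cs) (term-after (strip (suc f) b (suc q′) l s′)) ∎
    where
    q′ = suc q
    s′ = ((q′ , suc b) , suc f) ∷ s
    K  = cellsOf (q′ , b , suc f)
    L  = cellsOfAll (rowsFrom (suc q′) (suc f) l)
    L′ = cellsOfAll (rowsFrom (suc q′) (suc f) (trim b l))
    rotate : ∀ as bs → (as ++ bs) ++ cs ↭ bs ++ as ++ cs
    rotate as bs = ↭-trans (++⁺ʳ cs (++-comm as bs)) (↭-reflexive (Lₚ.++-assoc bs as cs))

  Earlier : ℕ → ℕ → Row → Set
  Earlier i f (r , _ , g) = r ℕ.< i × g ℕ.≤ f

  -- The summation over the box (i , b + 1) is made outermost and its top value f + 1 is split off.
  -- Since μ_r ≤ b for all r ≥ i, every row of length b + 1 from i on does have a box in column b +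
  -- 1, so trimming removes an unbroken strip.
  fillRows-step : ∀ (P : List Row) f i b l → f ℕ.< m → b ℕ.< part la 1 → All (Earlier i f) P →
    (∀ r → i ℕ.≤ r → part mu r ℕ.≤ b) → Descending (suc b) l →
    fillRows (P ++ rowsFrom i (suc f) (suc b ∷ l)) ≈
    fillRows (P ++ (i , suc b , f) ∷ rowsFrom (suc i) (suc f) l) +
    x (suc f) * fillRows (P ++ rowsFrom i (suc f) (b ∷ trim b l))
  fillRows-step P f i b l f<m b< ps μ≤ desc = begin
    fillSum (cellsOfAll (P ++ rowsFrom i (suc f) (suc b ∷ l))) term
      ≡⟨ ≡.cong (λ cs → fillSum cs term) (≡.trans (split _)
           (≡.cong (λ cells → CP ++ cells ++ L) (cellsOf-suc i (suc f) (μ≤ i ℕₚ.≤-refl)))) ⟩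
    fillSum (CP ++ (((i , suc b) , suc f) ∷ K) ++ L) term
      ≈⟨ fillSum-↭ term-↭ (rotate (((i , suc b) , suc f) ∷ K) L) ⟩
    ∑ f (λ a → fillSum (K ++ L ++ CP) (term-after (((i , suc b) , a) ∷ [])))
      + fillSum (K ++ L ++ CP) (term-after s)
      ≈⟨ +-cong (∑-cong f (λ a a≤f → fillSum-lowerRow (b ℕ.∸ part mu i) (part mu i) f i a (((i , suc b) , a) ∷ []) (L ++ CP)
                  (here (≡.cong (λ j → (i , j) , a) (μ+suc i (μ≤ i ℕₚ.≤-refl)))) a≤f))
                strip-part ⟩
    fillSum ((((i , suc b) , f) ∷ K₀) ++ L ++ CP) term
      + x (suc f) * fillRows (P ++ rowsFrom i (suc f) (b ∷ trim b l))
      ≈⟨ +-congʳ (trans (fillSum-↭ term-↭ (↭-sym (rotate (((i , suc b) , f) ∷ K₀) L)))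
           (reflexive (≡.cong (λ cs → fillSum cs term) (≡.sym (≡.trans (split _)
             (≡.cong (λ cells → CP ++ cells ++ L) (cellsOf-suc i f (μ≤ i ℕₚ.≤-refl)))))))) ⟩
    fillRows (P ++ (i , suc b , f) ∷ rowsFrom (suc i) (suc f) l)
      + x (suc f) * fillRows (P ++ rowsFrom i (suc f) (b ∷ trim b l)) ∎
    where
    CP = cellsOfAll P
    K  = cellsOf (i , b , suc f)
    K₀ = cellsOf (i , b , f)
    L  = cellsOfAll (rowsFrom (suc i) (suc f) l)
    L′ = cellsOfAll (rowsFrom (suc i) (suc f) (trim b l))
    s  = ((i , suc b) , suc f) ∷ []
    s′ = strip (suc f) b (suc i) l s

    split : ∀ Q → cellsOfAll (P ++ Q) ≡ CP ++ cellsOfAll Q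
    split Q = Lₚ.concatMap-++ cellsOf P Q

    rotate : ∀ as bs → CP ++ as ++ bs ↭ as ++ bs ++ CP
    rotate as bs = ↭-trans (++-comm CP (as ++ bs)) (↭-reflexive (Lₚ.++-assoc as bs CP))

    Bounded : Cell × ℕ → Set
    Bounded (d , β) = ∀ a → a ℕ.≤ β → Trimmed i b f d a

    bounded-rows : ∀ r l → i ℕ.≤ r → Descending b l → All Bounded (cellsOfAll (rowsFrom r (suc f) l))
    bounded-rows r []      i≤r _         = []
    bounded-rows r (a ∷ l) i≤r (a≤b , d) = Allₚ.++⁺
      (All-rowCells (suc f) r (part mu r) _ (λ j j≤ a′ a′≤ → a′≤ , inj₂ (ℕₚ.≤-trans j≤ (m+[n∸m]≤o (μ≤ r i≤r) a≤b))))
      (bounded-rows (suc r) l (ℕₚ.m≤n⇒m≤1+n i≤r) (descending-mono l a≤b d))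

    bounded-earlier : ∀ P → All (Earlier i f) P → All Bounded (cellsOfAll P)
    bounded-earlier []              []                 = []
    bounded-earlier ((r , a , g) ∷ P) ((r<i , g≤f) ∷ ps) = Allₚ.++⁺
      (All-rowCells g r (part mu r) _ (λ j _ a′ a′≤g →
        ℕₚ.m≤n⇒m≤1+n (ℕₚ.≤-trans a′≤g g≤f) , inj₁ (r<i , ℕₚ.≤-trans a′≤g g≤f)))
      (bounded-earlier P ps)

    strip-part : fillSum (K ++ L ++ CP) (term-after s) ≈
                 x (suc f) * fillRows (P ++ rowsFrom i (suc f) (b ∷ trim b l))
    strip-part = begin
      fillSum (K ++ L ++ CP) (term-after s)
        ≈⟨ fillSum-↭ (after-↭ s) (↭-trans (↭-sym (rotate K L)) (rotate′ K L)) ⟩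
      fillSum (L ++ K ++ CP) (term-after s)
        ≈⟨ fillSum-strip f b i l s (K ++ CP) (λ r i<r → μ≤ r (ℕₚ.<⇒≤ i<r)) (here ≡.refl) ⟩
      fillSum (L′ ++ K ++ CP) (term-after s′)
        ≈⟨ fillSum-congOn (Trimmed i b f) (L′ ++ K ++ CP)
             (Allₚ.++⁺ (bounded-rows (suc i) (trim b l) (ℕₚ.n≤1+n i) (trim-descending b l desc))
               (Allₚ.++⁺ (Allₚ.++⁻ˡ K (bounded-rows i (b ∷ []) ℕₚ.≤-refl (ℕₚ.≤-refl , _))) (bounded-earlier P ps)))
             (λ t pt → term-strip s′ t f<m b<
               (strip-nonempty (suc i) l s (λ ()))
               (strip-Strip (suc i) l s (ℕₚ.n≤1+n i) ((i , ℕₚ.≤-refl , ≡.refl) ∷ [])) pt) ⟩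
      fillSum (L′ ++ K ++ CP) (λ t → x (suc f) * term t)
        ≈⟨ fillSum-scale (L′ ++ K ++ CP) (x (suc f)) term ⟩
      x (suc f) * fillSum (L′ ++ K ++ CP) term
        ≈⟨ *-congˡ (trans (fillSum-↭ term-↭ (↭-sym (rotate′ K L′)))
             (reflexive (≡.cong (λ cs → fillSum cs term) (≡.sym (split (rowsFrom i (suc f) (b ∷ trim b l))))))) ⟩
      x (suc f) * fillRows (P ++ rowsFrom i (suc f) (b ∷ trim b l)) ∎
      where
      rotate′ : ∀ as bs → CP ++ as ++ bs ↭ bs ++ as ++ CP
      rotate′ as bs = ↭-trans (++⁺ˡ CP (++-comm as bs)) (rotate bs as)

  fillRows-emptyRow : ∀ (P : List Row) f i b Q → b ℕ.≤ part mu i →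
    fillRows (P ++ (i , b , suc f) ∷ Q) ≈ fillRows (P ++ (i , b , f) ∷ Q)
  fillRows-emptyRow P f i b Q le = reflexive (≡.cong (λ cs → fillSum cs term)
    (≡.trans (Lₚ.concatMap-++ cellsOf P _) (≡.trans
      (≡.cong (λ cells → cellsOfAll P ++ cells ++ cellsOfAll Q)
        (≡.trans (cellsOf-empty i (suc f) le) (≡.sym (cellsOf-empty i f le))))
      (≡.sym (Lₚ.concatMap-++ cellsOf P _)))))

  fillRows-noVariables-equal : ∀ i Q → fillRows ((i , part mu i , 0) ∷ Q) ≈ fillRows Q
  fillRows-noVariables-equal i Q =
    reflexive (≡.cong (λ cells → fillSum (cells ++ cellsOfAll Q) term) (cellsOf-empty i 0 ℕₚ.≤-refl))

  fillRows-noVariables-longer : ∀ i a Q → part mu i ℕ.< a → fillRows ((i , a , 0) ∷ Q) ≈ 0#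
  fillRows-noVariables-longer i (suc a) Q lt =
    reflexive (≡.cong (λ cells → fillSum (cells ++ cellsOfAll Q) term) (cellsOf-suc i 0 (ℕ.s≤s⁻¹ lt)))

-- Lists of row lengths: containment, trimming, padding, enumeration

Contains : List ℕ → ℕ → List ℕ → Set
Contains mu i []      = ⊤
Contains mu i (a ∷ l) = part mu i ℕ.≤ a × Contains mu (suc i) l

Contains-∷ʳ : ∀ mu i l {a} → Contains mu i l → part mu (i ℕ.+ length l) ℕ.≤ a → Contains mu i (l ++ a ∷ [])
Contains-∷ʳ mu i []      {a} _         le = ≡.subst (λ k → part mu k ℕ.≤ a) (ℕₚ.+-identityʳ i) le , tt
Contains-∷ʳ mu i (b ∷ l) {a} (b≥ , cs) le =
  b≥ , Contains-∷ʳ mu (suc i) l cs (≡.subst (λ k → part mu k ℕ.≤ a) (ℕₚ.+-suc i (length l)) le)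

rowsFrom-∷ʳ : ∀ i f l a → rowsFrom i f (l ++ a ∷ []) ≡ rowsFrom i f l ++ (i ℕ.+ length l , a , f) ∷ []
rowsFrom-∷ʳ i f []      a = ≡.cong (λ k → (k , a , f) ∷ []) (≡.sym (ℕₚ.+-identityʳ i))
rowsFrom-∷ʳ i f (b ∷ l) a = ≡.cong ((i , b , f) ∷_) (≡.trans (rowsFrom-∷ʳ (suc i) f l a)
  (≡.cong (λ k → rowsFrom (suc i) f l ++ (k , a , f) ∷ []) (≡.sym (ℕₚ.+-suc i (length l)))))

length-rowsFrom : ∀ i f l → length (rowsFrom i f l) ≡ length l
length-rowsFrom i f []      = ≡.refl
length-rowsFrom i f (a ∷ l) = ≡.cong suc (length-rowsFrom (suc i) f l)

length-∷ʳ : ∀ {A : Set} (l : List A) a → length (l ++ a ∷ []) ≡ suc (length l)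
length-∷ʳ l a = ≡.trans (Lₚ.length-++ l) (ℕₚ.+-comm (length l) 1)

descending-suffix : ∀ {b} l l′ → Descending b (l ++ l′) → Descending b l′
descending-suffix []      l′ d         = d
descending-suffix (a ∷ l) l′ (a≤b , d) = descending-mono l′ a≤b (descending-suffix l l′ d)

descending-replace : ∀ {b} l {l₁ l₂} → (∀ {c} → Descending c l₁ → Descending c l₂) →
                     Descending b (l ++ l₁) → Descending b (l ++ l₂)
descending-replace []      g d         = g d
descending-replace (a ∷ l) g (a≤b , d) = a≤b , descending-replace l g d

trim-length : ∀ c l → length (trim c l) ≡ length l
trim-length c []      = ≡.refl
trim-length c (a ∷ l) with a ℕ.≟ suc c
... | yes _ = ≡.cong suc (trim-length c l)
... | no  _ = ≡.refl

trim-contains : ∀ mu c i l → (∀ r → i ℕ.≤ r → part mu r ℕ.≤ c) → Contains mu i l → Contains mu i (trim c l)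
trim-contains mu c i []      μ≤ _        = tt
trim-contains mu c i (a ∷ l) μ≤ (a≥ , k) with a ℕ.≟ suc c
... | yes _ = μ≤ i ℕₚ.≤-refl , trim-contains mu c (suc i) l (λ r i<r → μ≤ r (ℕₚ.<⇒≤ i<r)) k
... | no  _ = a≥ , k

-- The induction measure. A row counts one more than its length, so the measure drops both when a
-- row is shortened and when a row, possibly of length 0, is handed over to the prefix.
size : List ℕ → ℕ
size []      = 0
size (a ∷ l) = suc a ℕ.+ size l

trim-size : ∀ c l → size (trim c l) ℕ.≤ size l
trim-size c []      = ℕ.z≤n
trim-size c (a ∷ l) with a ℕ.≟ suc c
... | yes ≡.refl = ℕₚ.m≤n⇒m≤1+n (ℕ.s≤s (ℕₚ.+-monoʳ-≤ c (trim-size c l)))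
... | no  _      = ℕₚ.≤-refl

pad : ℕ → List ℕ → List ℕ
pad zero    l       = []
pad (suc n) []      = 0 ∷ pad n []
pad (suc n) (a ∷ l) = a ∷ pad n l

length-pad : ∀ n l → length (pad n l) ≡ n
length-pad zero    l       = ≡.refl
length-pad (suc n) []      = ≡.cong suc (length-pad n [])
length-pad (suc n) (a ∷ l) = ≡.cong suc (length-pad n l)

pad-descending : ∀ n b l → Linked (λ a a′ → a′ ℕ.≤ a) (b ∷ l) → Descending b (pad n l)
pad-descending zero    b l       _          = tt
pad-descending (suc n) b []      _          = ℕ.z≤n , pad-descending n 0 [] [-]
pad-descending (suc n) b (a ∷ l) (a≤b ∷ ls) = a≤b , pad-descending n a l ls

pad-descending-part : ∀ n l → Linked (λ a a′ → a′ ℕ.≤ a) l → Descending (part l 1) (pad n l)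
pad-descending-part n       []      _  = pad-descending n 0 [] [-]
pad-descending-part zero    (a ∷ l) _  = tt
pad-descending-part (suc n) (a ∷ l) ls = ℕₚ.≤-refl , pad-descending n a l ls

pad-contains : ∀ mu n i l → (∀ t → part mu (i ℕ.+ t) ℕ.≤ l ‼ t) → Contains mu i (pad n l)
pad-contains mu zero    i l       μ≤ = tt
pad-contains mu (suc n) i []      μ≤ =
  ≡.subst (λ k → part mu k ℕ.≤ 0) (ℕₚ.+-identityʳ i) (μ≤ 0) ,
  pad-contains mu n (suc i) [] (λ t → ≡.subst (λ k → part mu k ℕ.≤ 0) (ℕₚ.+-suc i t) (μ≤ (suc t)))
pad-contains mu (suc n) i (a ∷ l) μ≤ =
  ≡.subst (λ k → part mu k ℕ.≤ a) (ℕₚ.+-identityʳ i) (μ≤ 0) ,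
  pad-contains mu n (suc i) l (λ t → ≡.subst (λ k → part mu k ℕ.≤ l ‼ t) (ℕₚ.+-suc i t) (μ≤ (suc t)))

linked⇒antitone : ∀ {l} → Linked (λ a b → b ℕ.≤ a) l → ∀ {s t} → s ℕ.≤ t → l ‼ t ℕ.≤ l ‼ s
linked⇒antitone {[]}        _          _                           = ℕ.z≤n
linked⇒antitone {a ∷ l}     _          {zero}  {zero}  _           = ℕₚ.≤-refl
linked⇒antitone {a ∷ []}    _          {zero}  {suc t} _           = ℕ.z≤n
linked⇒antitone {a ∷ b ∷ l} (b≤a ∷ ls) {zero}  {suc t} _           = ℕₚ.≤-trans (linked⇒antitone ls (ℕ.z≤n {t})) b≤a
linked⇒antitone {a ∷ []}    _          {suc s} {suc t} _           = ℕ.z≤n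
linked⇒antitone {a ∷ b ∷ l} (b≤a ∷ ls) {suc s} {suc t} (ℕ.s≤s s≤t) = linked⇒antitone ls s≤t

concatMap-↭ : ∀ {A B : Set} {f g : A → List B} → (∀ a → f a ↭ g a) → ∀ as → concatMap f as ↭ concatMap g as
concatMap-↭ f↭g []       = Perm.refl
concatMap-↭ f↭g (a ∷ as) = ++⁺ (f↭g a) (concatMap-↭ f↭g as)

tabulate≡upFrom : ∀ n a → tabulate {n = n} (λ j → a ℕ.+ toℕ j) ≡ upFrom a n
tabulate≡upFrom zero    a = ≡.refl
tabulate≡upFrom (suc n) a = ≡.cong₂ _∷_ (ℕₚ.+-identityʳ a)
  (≡.trans (Lₚ.tabulate-cong (λ j → ℕₚ.+-suc a (toℕ j))) (tabulate≡upFrom n (suc a)))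

tabulate≡rowsFrom : ∀ n i f l → tabulate {n = n} (λ j → (i ℕ.+ toℕ j , l ‼ toℕ j , f)) ≡ rowsFrom i f (pad n l)
tabulate≡rowsFrom zero    i f l       = ≡.refl
tabulate≡rowsFrom (suc n) i f []      = ≡.cong₂ _∷_ (≡.cong (λ k → (k , 0 , f)) (ℕₚ.+-identityʳ i))
  (≡.trans (Lₚ.tabulate-cong (λ j → ≡.cong (λ k → (k , 0 , f)) (ℕₚ.+-suc i (toℕ j)))) (tabulate≡rowsFrom n (suc i) f []))
tabulate≡rowsFrom (suc n) i f (a ∷ l) = ≡.cong₂ _∷_ (≡.cong (λ k → (k , a , f)) (ℕₚ.+-identityʳ i))
  (≡.trans (Lₚ.tabulate-cong (λ j → ≡.cong (λ k → (k , l ‼ toℕ j , f)) (ℕₚ.+-suc i (toℕ j)))) (tabulate≡rowsFrom n (suc i) f l))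

rowCells-↭ : ∀ m i lo d → map (_, m) (map (i ,_) (map (λ t → lo ℕ.+ suc t) (upTo d))) ↭ rowCells m i lo d
rowCells-↭ m i lo zero    = Perm.refl
rowCells-↭ m i lo (suc d) = ↭-trans (↭-reflexive eq)
  (↭-trans (++-comm (built d) (cell ∷ [])) (Perm.prep cell (rowCells-↭ m i lo d)))
  where
  cell : Cell × ℕ
  cell = (i , lo ℕ.+ suc d) , m
  g : ℕ → Cell × ℕ
  g t = (i , lo ℕ.+ suc t) , m
  built : ℕ → List (Cell × ℕ)
  built d = map (_, m) (map (i ,_) (map (λ t → lo ℕ.+ suc t) (upTo d)))
  fuse : ∀ d → built d ≡ map g (upTo d)
  fuse d = ≡.trans (≡.cong (map (_, m)) (≡.sym (Lₚ.map-∘ (upTo d)))) (≡.sym (Lₚ.map-∘ (upTo d)))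
  eq : built (suc d) ≡ built d ++ cell ∷ []
  eq = ≡.trans (fuse (suc d)) (≡.trans (≡.cong (map g) (≡.sym (Lₚ.upTo-∷ʳ d)))
      (≡.trans (Lₚ.map-++ g (upTo d) (d ∷ [])) (≡.cong (_++ cell ∷ []) (≡.sym (fuse d)))))

-- Translation of both sides to rows with bounds, and the induction

module Main {c ℓ : Level} (R : CommutativeRing c ℓ) (x : ℕ → CommutativeRing.Carrier R)
  (m : ℕ) (la mu : List ℕ) where
  open CommutativeRing R
  open SetoidReasoning setoid
  open Determinants R
  open Sums R
  open Fillings R
  open JacobiTrudi R x mu
  open Weighted R x m la mu

  cellsOfAll-pad : ∀ i l n → length l ℕ.≤ n →
    concatMap (λ t → cellsOf (i ℕ.+ t , l ‼ t , m)) (upTo (length l)) ≡ cellsOfAll (rowsFrom i m (pad n l))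
  cellsOfAll-pad i []      zero    _        = ≡.refl
  cellsOfAll-pad i []      (suc n) _        =
    ≡.trans (cellsOfAll-pad (suc i) [] n ℕ.z≤n)
      (≡.cong (_++ cellsOfAll (rowsFrom (suc i) m (pad n []))) (≡.sym (cellsOf-empty i m ℕ.z≤n)))
  cellsOfAll-pad i (a ∷ l) (suc n) (ℕ.s≤s le) = ≡.cong₂ _++_ (≡.cong (λ k → cellsOf (k , a , m)) (ℕₚ.+-identityʳ i))
    (≡.trans (≡.cong (concatMap (λ t → cellsOf (i ℕ.+ t , (a ∷ l) ‼ t , m))) (≡.sym (Lₚ.map-upTo suc (length l))))
    (≡.trans (Lₚ.concatMap-map (λ t → cellsOf (i ℕ.+ t , (a ∷ l) ‼ t , m)) suc (upTo (length l)))
    (≡.trans (Lₚ.concatMap-cong (λ t → ≡.cong (λ k → cellsOf (k , l ‼ t , m)) (ℕₚ.+-suc i t)) (upTo (length l)))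
      (cellsOfAll-pad (suc i) l n le))))

  cells-↭ : ∀ n → length la ℕ.≤ n → map (_, m) (cells la mu) ↭ cellsOfAll (rowsFrom 1 m (pad n la))
  cells-↭ n le = ↭-trans (↭-reflexive (≡.trans
      (Lₚ.map-concatMap (_, m) (λ i → map (i ,_) (range (part mu i) (part la i))) (range 0 (length la)))
      (Lₚ.concatMap-map (λ i → map (_, m) (map (i ,_) (range (part mu i) (part la i)))) suc (upTo (length la)))))
    (↭-trans (concatMap-↭ (λ t → rowCells-↭ m (suc t) (part mu (suc t)) (la ‼ t ℕ.∸ part mu (suc t))) (upTo (length la)))
      (↭-reflexive (cellsOfAll-pad 1 la n le)))

  gR≈fillRows : ∀ n → length la ℕ.≤ n → gR R m x la mu ≈ fillRows (rowsFrom 1 m (pad n la))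
  gR≈fillRows n le = begin
    gR R m x la mu
      ≈⟨ sumR-filter isRPP weight (zip (cells la mu)) (words m (length (cells la mu))) ⟩
    sumR R (map (λ w → term (zip (cells la mu) w)) (words m (length (cells la mu))))
      ≈⟨ sumR-words m (length (cells la mu)) _ ⟩
    wordSum m (length (cells la mu)) (λ w → term (zip (cells la mu) w))
      ≈⟨ fillSum-words m (cells la mu) term ⟩
    fillSum (map (_, m) (cells la mu)) term
      ≈⟨ fillSum-↭ term-↭ (cells-↭ n le) ⟩
    fillRows (rowsFrom 1 m (pad n la)) ∎

  det≈detRows : ∀ n → det R n (jtMatrix R m x la mu n) ≈ detRows (rowsFrom 1 m (pad n la)) (upFrom 1 n)
  det≈detRows n = trans
    (det≈detL n (λ i → vec (suc (toℕ i) , la ‼ toℕ i , m)) (λ j → suc (toℕ j)))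
    (reflexive (≡.cong₂ detL
      (≡.trans (≡.sym (Lₚ.map-tabulate (λ i → (suc (toℕ i) , la ‼ toℕ i , m)) vec)) (≡.cong (map vec) (tabulate≡rowsFrom n 1 m la)))
      (tabulate≡upFrom n 1)))

  colCount-[] : ∀ v → colCount la [] v ≡ 0
  colCount-[] v = go (range 0 (part la 1))
    where
    go : ∀ js → count (λ _ → false) js ≡ 0
    go []       = ≡.refl
    go (_ ∷ js) = go js

  term-[] : term [] ≈ 1#
  term-[] = trans (prodR-range-cong m (λ v _ → reflexive (≡.cong (powR R (x v)) (colCount-[] v)))) (ones (range 0 m))
    where
    ones : ∀ vs → prodR R (map (λ _ → 1#) vs) ≈ 1#
    ones []       = refl
    ones (_ ∷ vs) = trans (*-identityˡ _) (ones vs)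

  module _ (anti : Antitone) where

    -- Rows with λ_i = μ_i are removed from the top. The first longer row makes both sides 0: it
    -- vanishes on the remaining columns, and its boxes admit no entry.
    agree-noVariables : ∀ i b l → 1 ℕ.≤ i → Descending b l → Contains mu i l →
      detRows (rowsFrom i 0 l) (upFrom i (length l)) ≈ fillRows (rowsFrom i 0 l)
    agree-noVariables i b []      1≤i _       _        = sym term-[]
    agree-noVariables i b (a ∷ l) 1≤i (_ , d) (μ≤a , k) with ℕₚ.m≤n⇒m<n∨m≡n μ≤a
    ... | inj₁ μ<a    = trans (detRows-noVariables-longer anti i a l 1≤i μ<a)
                                (sym (fillRows-noVariables-longer i a (rowsFrom (suc i) 0 l) μ<a))
    ... | inj₂ ≡.refl = trans (detRows-noVariables-equal i l d) (trans
                          (agree-noVariables (suc i) (part mu i) l (ℕₚ.m≤n⇒m≤1+n 1≤i) d k)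
                          (sym (fillRows-noVariables-equal i (rowsFrom (suc i) 0 l))))

    rowsFrom-earlier : ∀ f l → All (Earlier (suc (length l)) f) (rowsFrom 1 f l)
    rowsFrom-earlier f l = go 1 l
      where
      go : ∀ i l → All (Earlier (i ℕ.+ length l) f) (rowsFrom i f l)
      go i []      = []
      go i (a ∷ l) = (ℕₚ.m<m+n i ℕₚ.0<1+n , ℕₚ.≤-refl) ∷
        ≡.subst (λ k → All (Earlier k f) (rowsFrom (suc i) f l)) (≡.sym (ℕₚ.+-suc i (length l))) (go (suc i) l)

    -- The shape varies while `la` stays fixed in the weight; the bound `part la 1` keeps all shapes
    -- within the columns that `colCount la` inspects.
    AgreeAt : ℕ → Set ℓ
    AgreeAt f = ∀ l → Descending (part la 1) l → Contains mu 1 l →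
                detRows (rowsFrom 1 f l) (upFrom 1 (length l)) ≈ fillRows (rowsFrom 1 f l)

    -- The border between the bounds f and f + 1 moves down: a row of length μ_i passes it at once,
    -- a longer one yields a term in which it passes and a term with a smaller shape. When no row is
    -- left below the border, the hypothesis for f applies. The number `k` bounds the measure,
    -- because a trimmed list is not a sublist.
    agree-split : ∀ f → f ℕ.< m → AgreeAt f → ∀ k n pre l → size l ℕ.≤ k → length pre ℕ.+ length l ≡ n →
      Descending (part la 1) (pre ++ l) → Contains mu 1 pre → Contains mu (suc (length pre)) l →
      let rs = rowsFrom 1 f pre ++ rowsFrom (suc (length pre)) (suc f) l in
      detRows rs (upFrom 1 n) ≈ fillRows rs
    agree-split f f<m ih k n pre [] sz eq d cp _ = begin
      detRows (rowsFrom 1 f pre ++ []) (upFrom 1 n)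
        ≡⟨ ≡.cong₂ (λ rs n → detRows rs (upFrom 1 n)) (Lₚ.++-identityʳ (rowsFrom 1 f pre))
             (≡.trans (≡.sym eq) (ℕₚ.+-identityʳ _)) ⟩
      detRows (rowsFrom 1 f pre) (upFrom 1 (length pre))
        ≈⟨ ih pre (≡.subst (Descending (part la 1)) (Lₚ.++-identityʳ pre) d) cp ⟩
      fillRows (rowsFrom 1 f pre)
        ≡⟨ ≡.cong fillRows (≡.sym (Lₚ.++-identityʳ (rowsFrom 1 f pre))) ⟩
      fillRows (rowsFrom 1 f pre ++ []) ∎
    agree-split f f<m ih (suc k) n pre (b ∷ l) (ℕ.s≤s sz) eq d cp (μ≤b , cl) = step (ℕₚ.m≤n⇒m<n∨m≡n μ≤b)
      where
      P = rowsFrom 1 f pre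
      i = suc (length pre)

      advance : detRows (P ++ (i , b , f) ∷ rowsFrom (suc i) (suc f) l) (upFrom 1 n) ≈
                fillRows (P ++ (i , b , f) ∷ rowsFrom (suc i) (suc f) l)
      advance = ≡.subst (λ rs → detRows rs (upFrom 1 n) ≈ fillRows rs) rows-eq
        (agree-split f f<m ih k n (pre ++ b ∷ []) l (ℕₚ.≤-trans (ℕₚ.m≤n+m (size l) b) sz)
          (≡.trans (≡.cong (ℕ._+ length l) (length-∷ʳ pre b)) (≡.trans (≡.sym (ℕₚ.+-suc (length pre) (length l))) eq))
          (≡.subst (Descending (part la 1)) (≡.sym (Lₚ.++-assoc pre (b ∷ []) l)) d)
          (Contains-∷ʳ mu 1 pre cp μ≤b)
          (≡.subst (λ j → Contains mu (suc j) l) (≡.sym (length-∷ʳ pre b)) cl))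
        where
        rows-eq : rowsFrom 1 f (pre ++ b ∷ []) ++ rowsFrom (suc (length (pre ++ b ∷ []))) (suc f) l ≡
                  P ++ (i , b , f) ∷ rowsFrom (suc i) (suc f) l
        rows-eq = ≡.trans
          (≡.cong₂ (λ Q j → Q ++ rowsFrom (suc j) (suc f) l) (rowsFrom-∷ʳ 1 f pre b) (length-∷ʳ pre b))
          (Lₚ.++-assoc P ((i , b , f) ∷ []) _)

      suffix : Descending (part la 1) (b ∷ l)
      suffix = descending-suffix pre (b ∷ l) d

      step : part mu i ℕ.< b ⊎ part mu i ≡ b →
             detRows (P ++ rowsFrom i (suc f) (b ∷ l)) (upFrom 1 n) ≈ fillRows (P ++ rowsFrom i (suc f) (b ∷ l))
      step (inj₂ μ≡b) = begin
        detRows (P ++ rowsFrom i (suc f) (b ∷ l)) (upFrom 1 n)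
          ≡⟨ ≡.cong (λ n → detRows (P ++ rowsFrom i (suc f) (b ∷ l)) (upFrom 1 n)) n≡ ⟩
        detRows (P ++ rowsFrom i (suc f) (b ∷ l)) (upFrom 1 (i ℕ.+ length l))
          ≈⟨ detRows-emptyRow anti P f i b l (length l) (≡.cong suc (≡.sym (length-rowsFrom 1 f pre)))
               (proj₂ suffix) (ℕₚ.≤-reflexive (≡.sym μ≡b)) ⟩
        detRows (P ++ (i , b , f) ∷ rowsFrom (suc i) (suc f) l) (upFrom 1 (i ℕ.+ length l))
          ≡⟨ ≡.cong (λ n → detRows (P ++ (i , b , f) ∷ rowsFrom (suc i) (suc f) l) (upFrom 1 n)) (≡.sym n≡) ⟩
        detRows (P ++ (i , b , f) ∷ rowsFrom (suc i) (suc f) l) (upFrom 1 n)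
          ≈⟨ advance ⟩
        fillRows (P ++ (i , b , f) ∷ rowsFrom (suc i) (suc f) l)
          ≈⟨ sym (fillRows-emptyRow P f i b _ (ℕₚ.≤-reflexive (≡.sym μ≡b))) ⟩
        fillRows (P ++ rowsFrom i (suc f) (b ∷ l)) ∎
        where
        n≡ : n ≡ i ℕ.+ length l
        n≡ = ≡.trans (≡.sym eq) (ℕₚ.+-suc (length pre) (length l))
      step (inj₁ (ℕ.s≤s {n = c} μ≤c)) = begin
        detRows (P ++ rowsFrom i (suc f) (suc c ∷ l)) (upFrom 1 n)
          ≈⟨ detRows-step P f i c l (upFrom 1 n) ⟩
        detRows (P ++ (i , suc c , f) ∷ rowsFrom (suc i) (suc f) l) (upFrom 1 n) +
          x (suc f) * detRows (P ++ rowsFrom i (suc f) (c ∷ trim c l)) (upFrom 1 n)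
          ≈⟨ +-cong advance (*-congˡ (agree-split f f<m ih k n pre (c ∷ trim c l)
               (ℕₚ.≤-trans (ℕ.s≤s (ℕₚ.+-monoʳ-≤ c (trim-size c l))) sz)
               (≡.trans (≡.cong (λ j → length pre ℕ.+ suc j) (trim-length c l)) eq)
               (descending-replace pre (λ { (c≤ , d′) → ℕₚ.≤-trans (ℕₚ.n≤1+n c) c≤ , trim-descending c l d′ }) d)
               cp (μ≤c , trim-contains mu c (suc i) l (λ r i<r → below r (ℕₚ.<⇒≤ i<r)) cl))) ⟩
        fillRows (P ++ (i , suc c , f) ∷ rowsFrom (suc i) (suc f) l) +
          x (suc f) * fillRows (P ++ rowsFrom i (suc f) (c ∷ trim c l))
          ≈⟨ sym (fillRows-step P f i c l f<m (proj₁ suffix) (rowsFrom-earlier f pre) below (proj₂ suffix)) ⟩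
        fillRows (P ++ rowsFrom i (suc f) (suc c ∷ l)) ∎
        where
        below : ∀ r → i ℕ.≤ r → part mu r ℕ.≤ c
        below r i≤r = ℕₚ.≤-trans (anti i r (ℕ.s≤s ℕ.z≤n) i≤r) μ≤c

    agree : ∀ f → f ℕ.≤ m → AgreeAt f
    agree zero    _   l d k = agree-noVariables 1 (part la 1) l ℕₚ.≤-refl d k
    agree (suc f) f<m l d k =
      agree-split f f<m (agree f (ℕₚ.<⇒≤ f<m)) (size l) (length l) [] l ℕₚ.≤-refl ≡.refl d tt k

theorem4p1 : {c ℓ : Level} (R : CommutativeRing c ℓ) (m : ℕ) (x : ℕ → CommutativeRing.Carrier R)
    (la mu : List ℕ) (n : ℕ) →
    IsPartition la → IsPartition mu → la ⊇ mu → length la ≤ n → length mu ≤ n →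
    CommutativeRing._≈_ R (gR R m x la mu) (det R n (jtMatrix R m x la mu n))
theorem4p1 R m x la mu n (la-linked , _) (mu-linked , _) la⊇mu la≤n _ = begin
  gR R m x la mu
    ≈⟨ gR≈fillRows n la≤n ⟩
  fillRows (rowsFrom 1 m (pad n la))
    ≈⟨ sym (agree anti m ℕₚ.≤-refl (pad n la) (pad-descending-part n la la-linked)
         (pad-contains mu n 1 la (λ t → la⊇mu (suc t)))) ⟩
  detRows (rowsFrom 1 m (pad n la)) (upFrom 1 (length (pad n la)))
    ≡⟨ ≡.cong (λ n′ → detRows (rowsFrom 1 m (pad n la)) (upFrom 1 n′)) (length-pad n la) ⟩
  detRows (rowsFrom 1 m (pad n la)) (upFrom 1 n)
    ≈⟨ sym (det≈detRows n) ⟩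
  det R n (jtMatrix R m x la mu n) ∎
  where
  open CommutativeRing R
  open SetoidReasoning setoid
  open JacobiTrudi R x mu
  open Weighted R x m la mu
  open Main R x m la mu
  anti : Antitone
  anti (suc j) (suc i) _ (ℕ.s≤s j≤i) = linked⇒antitone mu-linked j≤i
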